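{- Let $n\ge 7$ and let $G$ be a connected simple graph with $n$ vertices and $n+1$ edges whose two cycles are vertex-disjoint (i.e. $G\in\mathcal{C}(p,q)$ for some $p,q$). If $G\not\cong T_n^1(3,3)$, then $\operatorname{avm}(G)>\operatorname{avm}(T_n^1(3,3))$.
   Context: $\operatorname{avm}(G)$ is the average of $|M|$ over all maximal matchings $M$ of $G$ (a matching is maximal if not properly contained in another matching). $\mathcal{C}(p,q)$ is the class of connected graphs with $n$ vertices and $n+1$ edges containing two vertex-disjoint cycles of lengths $p$ and $q$. $T_n^1(3,3)$ is the graph obtained from two vertex-disjoint triangles $v_1v_2v_3$ and $w_1w_2w_3$ joined by the edge $v_3w_1$ by attaching $n-6\ge1$ pendant edges (new leaves) to $v_3$. -}

module Defs where

open import Data.Bool using (Bool; true; false; _∨_; T)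
open import Data.Bool.Properties using (∨-comm; T?)
open import Data.Fin using (Fin; toℕ; _<?_; _≟_)
open import Data.Fin.Properties using (all?)
open import Data.Fin.Subset using (Subset; inside; outside; _∈_; _⊂_; ∣_∣) renaming (⊥ to ∅)
open import Data.Fin.Subset.Induction using (⊃-wellFounded; Acc; acc)
open import Data.Fin.Subset.Properties using (_∈?_; _⊂?_; anySubset?; ∉⊥)
open import Data.Integer using (+_)
open import Data.List using (List; []; _∷_; _++_; map; filter; length; lookup; allFin; cartesianProduct)
open import Data.List.Membership.Propositional using () renaming (_∈_ to _∈ₗ_)
open import Data.List.Membership.Propositional.Properties using (∈-map⁺; ∈-++⁺ˡ; ∈-++⁺ʳ; ∈-filter⁺; ∈-length)
open import Data.List.Relation.Unary.Any using (here)
open import Data.Nat as ℕ using (ℕ; zero; suc; NonZero)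
open import Data.Nat.ListAction using (sum)
open import Data.Product using (Σ-syntax; ∃-syntax; _×_; _,_; proj₁; proj₂)
open import Data.Rational using (ℚ; _/_)
open import Data.Sum using (_⊎_)
open import Data.Vec using ([]; _∷_)
open import Function using (_↔_; Inverse)
open import Function.Definitions using (Injective)
open import Relation.Binary.Construct.Closure.ReflexiveTransitive using (Star)
open import Relation.Binary.PropositionalEquality using (_≡_; _≢_; refl)
open import Relation.Nullary using (¬_; Dec; yes; no; contradiction)
open import Relation.Nullary.Decidable using (_×-dec_; _⊎-dec_; _→-dec_; ¬?)

record Graph (n : ℕ) : Set where
  field
    adj    : Fin n → Fin n → Bool
    sym    : ∀ u v → adj u v ≡ adj v u
    irrefl : ∀ u → adj u u ≡ false

  Adj : Fin n → Fin n → Set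
  Adj u v = T (adj u v)

open Graph public using (Adj)

Connected : ∀ {n} → Graph n → Set
Connected G = ∀ u v → Star (Adj G) u v

_≅_ : ∀ {n} → Graph n → Graph n → Set
_≅_ {n} G H =
  Σ[ φ ∈ Fin n ↔ Fin n ] ∀ u v → Graph.adj G u v ≡ Graph.adj H (Inverse.to φ u) (Inverse.to φ v)

-- Each edge is listed exactly once, with its smaller endpoint first.
edges : ∀ {n} → Graph n → List (Fin n × Fin n)
edges {n} G =
  filter (λ e → (proj₁ e <? proj₂ e) ×-dec T? (Graph.adj G (proj₁ e) (proj₂ e)))
    (cartesianProduct (allFin n) (allFin n))

#edges : ∀ {n} → Graph n → ℕ
#edges G = length (edges G)

record Cycle {n : ℕ} (G : Graph n) (p : ℕ) : Set where
  field
    3≤p       : 3 ℕ.≤ p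
    vertex    : Fin p → Fin n
    injective : Injective _≡_ _≡_ vertex
    step      : ∀ i j → toℕ j ≡ suc (toℕ i) → Adj G (vertex i) (vertex j)
    close     : ∀ i j → suc (toℕ i) ≡ p → toℕ j ≡ 0 → Adj G (vertex i) (vertex j)

record 𝒞 (p q : ℕ) {n : ℕ} (G : Graph n) : Set where
  field
    connected : Connected G
    size      : #edges G ≡ n ℕ.+ 1
    cycle₁    : Cycle G p
    cycle₂    : Cycle G q
    disjoint  : ∀ i j → Cycle.vertex cycle₁ i ≢ Cycle.vertex cycle₂ j

-- A set of edges is a set of positions in the list of edges.
EdgeSet : ∀ {n} → Graph n → Set
EdgeSet G = Subset (#edges G)

Incident : ∀ {n} (G : Graph n) → Fin n → Fin (#edges G) → Set
Incident G v e = v ≡ proj₁ (lookup (edges G) e) ⊎ v ≡ proj₂ (lookup (edges G) e)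

IsMatching : ∀ {n} (G : Graph n) → EdgeSet G → Set
IsMatching G M =
  ∀ e f → e ∈ M → f ∈ M → e ≢ f → ∀ v → ¬ (Incident G v e × Incident G v f)

IsMaximalMatching : ∀ {n} (G : Graph n) → EdgeSet G → Set
IsMaximalMatching G M = IsMatching G M × ¬ (∃[ N ] (IsMatching G N × M ⊂ N))

incident? : ∀ {n} (G : Graph n) v e → Dec (Incident G v e)
incident? G v e = (v ≟ proj₁ (lookup (edges G) e)) ⊎-dec (v ≟ proj₂ (lookup (edges G) e))

isMatching? : ∀ {n} (G : Graph n) M → Dec (IsMatching G M)
isMatching? G M =
  all? λ e → all? λ f → (e ∈? M) →-dec ((f ∈? M) →-dec (¬? (e ≟ f) →-dec
    all? λ v → ¬? (incident? G v e ×-dec incident? G v f)))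

isMaximalMatching? : ∀ {n} (G : Graph n) M → Dec (IsMaximalMatching G M)
isMaximalMatching? G M =
  isMatching? G M ×-dec ¬? (anySubset? λ N → isMatching? G N ×-dec (M ⊂? N))

allSubsets : ∀ n → List (Subset n)
allSubsets zero    = [] ∷ []
allSubsets (suc n) = map (outside ∷_) (allSubsets n) ++ map (inside ∷_) (allSubsets n)

maximalMatchings : ∀ {n} (G : Graph n) → List (EdgeSet G)
maximalMatchings G = filter (isMaximalMatching? G) (allSubsets (#edges G))

∈-allSubsets : ∀ {n} (M : Subset n) → M ∈ₗ allSubsets n
∈-allSubsets []            = here refl
∈-allSubsets (outside ∷ M) = ∈-++⁺ˡ (∈-map⁺ (outside ∷_) (∈-allSubsets M))
∈-allSubsets (inside  ∷ M) =
  ∈-++⁺ʳ (map (outside ∷_) (allSubsets _)) (∈-map⁺ (inside ∷_) (∈-allSubsets M))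

extendToMaximal : ∀ {n} (G : Graph n) M → IsMatching G M → ∃[ N ] IsMaximalMatching G N
extendToMaximal G M = go M (⊃-wellFounded M)
  where
  go : ∀ M → Acc (λ N M → M ⊂ N) M → IsMatching G M → ∃[ N ] IsMaximalMatching G N
  go M (acc rec) m with anySubset? (λ N → isMatching? G N ×-dec (M ⊂? N))
  ... | yes (N , n , M⊂N) = go N (rec M⊂N) n
  ... | no  none          = M , m , none

#maximalMatchings-nonZero : ∀ {n} (G : Graph n) → NonZero (length (maximalMatchings G))
#maximalMatchings-nonZero G with extendToMaximal G ∅ (λ e f e∈∅ → contradiction e∈∅ ∉⊥)
... | N , max = ℕ.>-nonZero (∈-length (∈-filter⁺ (isMaximalMatching? G) (∈-allSubsets N) max))

avm : ∀ {n} → Graph n → ℚ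
avm G = _/_ (+ sum (map ∣_∣ (maximalMatchings G))) (length (maximalMatchings G))
  {{#maximalMatchings-nonZero G}}

-- The edges of T_n^1(3,3), smaller endpoint first: v₁, v₂, v₃ are 0, 1, 2,
-- w₁, w₂, w₃ are 3, 4, 5, and the vertices from 6 on are the leaves at v₃.
T¹₃₃-edge : ℕ → ℕ → Bool
T¹₃₃-edge 0 1 = true
T¹₃₃-edge 0 2 = true
T¹₃₃-edge 1 2 = true
T¹₃₃-edge 3 4 = true
T¹₃₃-edge 3 5 = true
T¹₃₃-edge 4 5 = true
T¹₃₃-edge 2 3 = true
T¹₃₃-edge 2 (suc (suc (suc (suc (suc (suc _)))))) = true
T¹₃₃-edge _ _ = false

T¹₃₃-edge-irrefl : ∀ a → T¹₃₃-edge a a ∨ T¹₃₃-edge a a ≡ false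
T¹₃₃-edge-irrefl 0 = refl
T¹₃₃-edge-irrefl 1 = refl
T¹₃₃-edge-irrefl 2 = refl
T¹₃₃-edge-irrefl 3 = refl
T¹₃₃-edge-irrefl 4 = refl
T¹₃₃-edge-irrefl (suc (suc (suc (suc (suc _))))) = refl

-- Meaningful for n ≥ 7 only.
T¹₃₃ : ∀ n → Graph n
T¹₃₃ n = record
  { adj    = λ u v → T¹₃₃-edge (toℕ u) (toℕ v) ∨ T¹₃₃-edge (toℕ v) (toℕ u)
  ; sym    = λ u v → ∨-comm (T¹₃₃-edge (toℕ u) (toℕ v)) (T¹₃₃-edge (toℕ v) (toℕ u))
  ; irrefl = λ u → T¹₃₃-edge-irrefl (toℕ u)
  }

{-# OPTIONS --safe #-}
module Submission where

-- Let k = n − 6, so that avm(T_n^1(3,3)) = 3 − 6/(3k + 7). A maximal matching covers two vertices of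
-- each of the two disjoint cycles, so it has size at least 2, and only those of size 2 pull the average
-- below 3. If there is one, its four vertices cover all edges, and counting edges shows that G consists
-- of two triangles A and B joined by at most one edge, plus k independent vertices adjacent to A ∪ B.
-- A maximal matching of size 2 is then an edge of A and an edge of B such that the two vertices left
-- over are nonadjacent and have no neighbour outside A ∪ B. This leaves at most 3, 4 or 5 of them unless
-- all outside vertices hang on the end in A (or B) of the edge joining A and B, which is T_n^1(3,3).
-- Larger maximal matchings are plentiful: a vertex l outside adjacent to i ∈ A extends {il, A − i} by
-- each of the three edges of B, and pairwise incompatible matchings extend to different maximal ones.

open import Defs
open import Data.Bool using (Bool; true; false; T; _∨_)
open import Data.Bool.Properties using (T?; ∨-comm)
open import Data.Empty using (⊥; ⊥-elim)
open import Data.Fin using (Fin; zero; suc; toℕ; fromℕ<; inject₁; _↑ˡ_; _↑ʳ_; punchOut; _≟_)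
open import Data.Fin.Patterns using (0F; 1F; 2F; 3F; 4F; 5F; 6F; 7F)
open import Data.Fin.Permutation using (Permutation′; _⟨$⟩ʳ_; _⟨$⟩ˡ_; inverseˡ; insert; insert-punchIn) renaming (id to idₚ)
open import Data.Fin.Properties using (all?; any?; <-cmp; toℕ-injective; toℕ<n; toℕ-fromℕ<; toℕ-inject₁; punchOut-injective; punchIn-punchOut; 0≢1+n)
open import Data.Fin.Subset using (Subset; inside; outside; ∣_∣; _∈_; _⊆_; _⊂_; _∪_; ⁅_⁆) renaming (⊥ to ∅)
open import Data.Fin.Subset.Induction using (⊃-wellFounded; Acc; acc)
open import Data.Fin.Subset.Properties using (_∈?_; _⊂?_; anySubset?; ∉⊥; ⊆-antisym; x∈p∪q⁻; x∈p∪q⁺; x∈⁅x⁆; x∈⁅y⁆⇒x≡y)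
open import Data.Integer using (+_)
open import Data.List using (List; []; _∷_; _++_; map; filter; length; lookup; allFin; tabulate; cartesianProduct)
open import Data.List.Membership.Propositional using (_∉_) renaming (_∈_ to _∈ₗ_)
open import Data.List.Membership.Propositional.Properties using (∈-map⁺; ∈-map⁻; ∈-++⁺ˡ; ∈-++⁺ʳ; ∈-++⁻; ∈-filter⁺; ∈-filter⁻; ∈-lookup; ∈-allFin; ∈-tabulate⁺; ∈-tabulate⁻; ∈-cartesianProduct⁺; ∈-cartesianProduct⁻; ∈-length)
open import Data.List.Properties using (length-map; length-++; length-tabulate; filter-≐)
open import Data.List.Relation.Unary.All as All using (All; []; _∷_)
open import Data.List.Relation.Unary.AllPairs using ([]; _∷_)
open import Data.List.Relation.Unary.Any using (here; there; index)
open import Data.List.Relation.Unary.Any.Properties using (lookup-index)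
open import Data.List.Relation.Unary.Unique.Propositional using (Unique)
open import Data.Nat using (ℕ; zero; suc; _+_; _*_; _≤_; _<_; s≤s; z≤n; _≤?_; _<?_; NonZero; >-nonZero⁻¹)
open import Data.Nat.ListAction using (sum)
open import Data.Nat.Solver using (module +-*-Solver)
open import Data.Product using (∃-syntax; Σ-syntax; _×_; _,_; proj₁; proj₂; swap)
open import Data.Product.Properties using (≡-dec)
open import Data.Sum using (_⊎_; inj₁; inj₂; [_,_]′)
open import Data.Sum.Properties using (inj₁-injective; inj₂-injective)
open import Data.Unit using (⊤; tt)
open import Data.Vec using ([]; _∷_; here; there)
open import Data.Vec.Properties using (∷-injectiveʳ)
open import Function using (_∘_; id; case_of_)
open import Relation.Binary using (tri<; tri≈; tri>)
open import Relation.Binary.Construct.Closure.ReflexiveTransitive using (Star; ε; _◅_)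
open import Relation.Binary.PropositionalEquality using (_≡_; _≢_; refl; sym; trans; cong; cong₂; subst; subst₂; ≢-sym)
open import Relation.Nullary using (¬_; Dec; yes; no; contradiction)
open import Relation.Nullary.Decidable using (_×-dec_; _⊎-dec_; ¬?; map′; from-yes; decidable-stable)
import Data.List.Membership.DecPropositional as DecMembership
import Data.List.Relation.Unary.Unique.DecPropositional as DecUnique
import Data.List.Relation.Unary.Unique.Propositional.Properties as Unique
import Data.Nat.Properties as ℕ
import Data.Sum as Sum
import Data.Rational as ℚ
import Data.Rational.Properties as ℚ
import Data.Rational.Unnormalised as ℚᵘ
import Data.Rational.Unnormalised.Properties as ℚᵘ
import Data.Integer as ℤ
import Data.Integer.Properties as ℤ

-- Put x = 3k + 7, so that avm(T_n^1(3,3)) = (3x - 6)/x. Cleared of denominators, each maximal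
-- matching of size 2 counts against G with weight x - 6 = 3k + 1, each larger one counts for it
-- with weight 6, and size at least 4 adds a further x. T_n^1(3,3) itself balances exactly: six of
-- size 2 against 3k + 1 of size 3. So three of size 2 are outweighed by the 3k matchings through
-- outside vertices, while for five and small k the one through the edge joining A and B is needed
-- too. If outside vertices hang on both triangles, one side may carry only half of them, and 3k/2
-- matchings of size 3 do not outweigh four of size 2; there matchings of size 4, using an outside
-- vertex on either side, make up the deficit. The edge count serves to exclude two edges between
-- the sides: each side spans as many edges as vertices, each remaining vertex brings one more edge,
-- and two connecting edges would give n + 2. Since the cycles have unknown lengths until the
-- triangles are found, they enter only as vertex sets in which every vertex has two neighbours of
-- the same set.

-- Counting in lists and finite subsets.

delete : ∀ {A : Set} {y : A} {ys} → y ∈ₗ ys →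
  ∃[ zs ] length ys ≡ suc (length zs) × (∀ {z} → z ∈ₗ ys → z ≢ y → z ∈ₗ zs)
delete {ys = _ ∷ ys} (here refl) = ys , refl , λ where
  (here refl) z≢y → contradiction refl z≢y
  (there z∈)  _   → z∈
delete {ys = w ∷ _} (there y∈) with delete y∈
... | zs , eq , keep = w ∷ zs , cong suc eq , λ where
  (here refl) _   → here refl
  (there z∈)  z≢y → there (keep z∈ z≢y)

-- Partners are given by a relation because in the applications they come from existence proofs,
-- such as extension to a maximal matching. The induction removes the partner of the head from `ys`;
-- injectivity keeps the other partners in place.
pigeonhole : ∀ {A B : Set} (R : A → B → Set) → (∀ {x x′ y} → R x y → R x′ y → x ≡ x′) →
  ∀ {xs ys} → Unique xs → (∀ {x} → x ∈ₗ xs → ∃[ y ] (y ∈ₗ ys × R x y)) →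
  length xs ≤ length ys
pigeonhole R inj {[]} [] _ = z≤n
pigeonhole R inj {x ∷ xs} {ys} (x∉xs ∷ xs!) f with f (here refl)
... | y , y∈ , r with delete y∈
... | zs , eq , keep = subst (suc (length xs) ≤_) (sym eq) (s≤s (pigeonhole R inj xs! g))
  where
  g : ∀ {x′} → x′ ∈ₗ xs → ∃[ y′ ] (y′ ∈ₗ zs × R x′ y′)
  g x′∈ with f (there x′∈)
  ... | y′ , y′∈ , r′ =
    y′ , keep y′∈ (λ { refl → All.lookup x∉xs x′∈ (inj r r′) }) , r′

unique-⊆⇒≤ : ∀ {A : Set} {xs ys : List A} → Unique xs → (∀ {x} → x ∈ₗ xs → x ∈ₗ ys) →
  length xs ≤ length ys
unique-⊆⇒≤ xs! sub = pigeonhole _≡_ (λ p q → trans p (sym q)) xs! (λ x∈ → _ , sub x∈ , refl)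

lookup-injective : ∀ {A : Set} {xs : List A} → Unique xs →
  ∀ i j → lookup xs i ≡ lookup xs j → i ≡ j
lookup-injective (_ ∷ _)  zero    zero    _  = refl
lookup-injective (p ∷ _)  zero    (suc j) eq = contradiction eq (All.lookup p (∈-lookup j))
lookup-injective (p ∷ _)  (suc i) zero    eq = contradiction (sym eq) (All.lookup p (∈-lookup i))
lookup-injective (_ ∷ us) (suc i) (suc j) eq = cong suc (lookup-injective us i j eq)

length-cartesianProduct : ∀ {A B : Set} (xs : List A) (ys : List B) →
  length (cartesianProduct xs ys) ≡ length xs * length ys
length-cartesianProduct []       ys = refl
length-cartesianProduct (x ∷ xs) ys = trans (length-++ (map (x ,_) ys))
  (cong₂ _+_ (length-map (x ,_) ys) (length-cartesianProduct xs ys))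

elements : ∀ {n} → Subset n → List (Fin n)
elements []            = []
elements (inside  ∷ p) = zero ∷ map suc (elements p)
elements (outside ∷ p) = map suc (elements p)

length-elements : ∀ {n} (p : Subset n) → length (elements p) ≡ ∣ p ∣
length-elements []            = refl
length-elements (inside  ∷ p) = cong suc (trans (length-map suc (elements p)) (length-elements p))
length-elements (outside ∷ p) = trans (length-map suc (elements p)) (length-elements p)

∈-elements⁺ : ∀ {n} {p : Subset n} {x} → x ∈ p → x ∈ₗ elements p
∈-elements⁺ {p = inside  ∷ p} here       = here refl
∈-elements⁺ {p = inside  ∷ p} (there x∈) = there (∈-map⁺ suc (∈-elements⁺ x∈))
∈-elements⁺ {p = outside ∷ p} (there x∈) = ∈-map⁺ suc (∈-elements⁺ x∈)

∈-elements⁻ : ∀ {n} {p : Subset n} {x} → x ∈ₗ elements p → x ∈ p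
∈-elements⁻ {p = inside ∷ p} (here refl) = here
∈-elements⁻ {p = inside ∷ p} (there x∈) with ∈-map⁻ suc x∈
... | _ , y∈ , refl = there (∈-elements⁻ y∈)
∈-elements⁻ {p = outside ∷ p} x∈ with ∈-map⁻ suc x∈
... | _ , y∈ , refl = there (∈-elements⁻ y∈)

elements-unique : ∀ {n} (p : Subset n) → Unique (elements p)
elements-unique []            = []
elements-unique (outside ∷ p) = Unique.map⁺ (λ { refl → refl }) (elements-unique p)
elements-unique (inside  ∷ p) =
  All.tabulate (λ x∈ → λ { refl → case ∈-map⁻ suc x∈ of λ () }) ∷
  Unique.map⁺ (λ { refl → refl }) (elements-unique p)

allSubsets-unique : ∀ n → Unique (allSubsets n)
allSubsets-unique zero    = [] ∷ []
allSubsets-unique (suc n) =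
  Unique.++⁺ (Unique.map⁺ ∷-injectiveʳ (allSubsets-unique n))
             (Unique.map⁺ ∷-injectiveʳ (allSubsets-unique n)) λ where
    (p , q) → case ∈-map⁻ (outside ∷_) p of λ where
      (_ , _ , refl) → case ∈-map⁻ (inside ∷_) q of λ ()

module _ {n : ℕ} where
  open DecMembership (_≟_ {n}) public using () renaming (_∈?_ to _∈ₗ?_)

rest : ∀ {n} → List (Fin n) → List (Fin n)
rest {n} vs = filter (λ v → ¬? (v ∈ₗ? vs)) (allFin n)

∈-rest⁺ : ∀ {n} {vs : List (Fin n)} {v} → v ∉ vs → v ∈ₗ rest vs
∈-rest⁺ v∉ = ∈-filter⁺ (λ v → ¬? (v ∈ₗ? _)) (∈-allFin _) v∉

∈-rest⁻ : ∀ {n} {vs : List (Fin n)} {v} → v ∈ₗ rest vs → v ∉ vs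
∈-rest⁻ {n} v∈ = proj₂ (∈-filter⁻ (λ v → ¬? (v ∈ₗ? _)) {xs = allFin n} v∈)

rest-unique : ∀ {n} (vs : List (Fin n)) → Unique (rest vs)
rest-unique vs = Unique.filter⁺ _ (Unique.allFin⁺ _)

≤-length-rest : ∀ {n} (vs : List (Fin n)) → n ≤ length vs + length (rest vs)
≤-length-rest {n} vs = subst₂ _≤_ (length-tabulate {n = n} id) (length-++ vs)
  (unique-⊆⇒≤ {ys = vs ++ rest vs} (Unique.allFin⁺ n) λ {v} _ → cover v)
  where
  cover : ∀ v → v ∈ₗ vs ++ rest vs
  cover v with v ∈ₗ? vs
  ... | yes v∈ = ∈-++⁺ˡ v∈
  ... | no  v∉ = ∈-++⁺ʳ vs (∈-rest⁺ v∉)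

length-rest-≤ : ∀ {n} {vs : List (Fin n)} → Unique vs → length vs + length (rest vs) ≤ n
length-rest-≤ {n} {vs} vs! = subst₂ _≤_ (length-++ vs) (length-tabulate {n = n} id)
  (unique-⊆⇒≤ (Unique.++⁺ vs! (rest-unique vs) (λ (p , q) → ∈-rest⁻ q p)) (λ _ → ∈-allFin _))

-- Edges, matchings and maximality in an arbitrary graph.

module _ {n : ℕ} (G : Graph n) where

  private
    V : Set
    V = Fin n

  adj-sym : ∀ {u v} → Adj G u v → Adj G v u
  adj-sym {u} {v} = subst T (Graph.sym G u v)

  adj⇒≢ : ∀ {u v} → Adj G u v → u ≢ v
  adj⇒≢ {u} uv refl = subst T (Graph.irrefl G u) uv

  edge? : (e : V × V) → Dec (proj₁ e Data.Fin.< proj₂ e × Adj G (proj₁ e) (proj₂ e))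
  edge? e = (proj₁ e Data.Fin.<? proj₂ e) ×-dec T? (Graph.adj G (proj₁ e) (proj₂ e))

  edges-unique : Unique (edges G)
  edges-unique = Unique.filter⁺ edge? (Unique.cartesianProduct⁺ (Unique.allFin⁺ n) (Unique.allFin⁺ n))

  ∈-edges⁻ : ∀ {e} → e ∈ₗ edges G → proj₁ e Data.Fin.< proj₂ e × Adj G (proj₁ e) (proj₂ e)
  ∈-edges⁻ e∈ = proj₂ (∈-filter⁻ edge? {xs = cartesianProduct (allFin n) (allFin n)} e∈)

  ∈-edges⁺ : ∀ {u v} → u Data.Fin.< v → Adj G u v → (u , v) ∈ₗ edges G
  ∈-edges⁺ u<v uv = ∈-filter⁺ edge? (∈-cartesianProduct⁺ (∈-allFin _) (∈-allFin _)) (u<v , uv)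

  Joins : Fin (#edges G) → V → V → Set
  Joins e u v = lookup (edges G) e ≡ (u , v) ⊎ lookup (edges G) e ≡ (v , u)

  joins-sym : ∀ {e u v} → Joins e u v → Joins e v u
  joins-sym (inj₁ p) = inj₂ p
  joins-sym (inj₂ p) = inj₁ p

  joins⇒adj : ∀ {e u v} → Joins e u v → Adj G u v
  joins⇒adj {e} (inj₁ p) = proj₂ (∈-edges⁻ (subst (_∈ₗ edges G) p (∈-lookup e)))
  joins⇒adj {e} (inj₂ p) = adj-sym (proj₂ (∈-edges⁻ (subst (_∈ₗ edges G) p (∈-lookup e))))

  adj⇒joins : ∀ {u v} → Adj G u v → ∃[ e ] Joins e u v
  adj⇒joins {u} {v} uv with <-cmp u v
  ... | tri< u<v _ _ = index e∈ , inj₁ (sym (lookup-index e∈))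
    where e∈ = ∈-edges⁺ u<v uv
  ... | tri≈ _ u≡v _ = contradiction u≡v (adj⇒≢ uv)
  ... | tri> _ _ v<u = index e∈ , inj₂ (sym (lookup-index e∈))
    where e∈ = ∈-edges⁺ v<u (adj-sym uv)

  joins-ends : ∀ {e u v u′ v′} → Joins e u v → Joins e u′ v′ → (u ≡ u′ × v ≡ v′) ⊎ (u ≡ v′ × v ≡ u′)
  joins-ends (inj₁ p) (inj₁ q) with refl ← trans (sym p) q = inj₁ (refl , refl)
  joins-ends (inj₁ p) (inj₂ q) with refl ← trans (sym p) q = inj₂ (refl , refl)
  joins-ends (inj₂ p) (inj₁ q) with refl ← trans (sym p) q = inj₂ (refl , refl)
  joins-ends (inj₂ p) (inj₂ q) with refl ← trans (sym p) q = inj₁ (refl , refl)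

  joins-unique : ∀ {e f u v} → Joins e u v → Joins f u v → e ≡ f
  joins-unique {e} {f} {u} {v} = go
    where
    increasing : ∀ {e u v} → lookup (edges G) e ≡ (u , v) → u Data.Fin.< v
    increasing {e} p = proj₁ (∈-edges⁻ (subst (_∈ₗ edges G) p (∈-lookup e)))
    go : Joins e u v → Joins f u v → e ≡ f
    go (inj₁ p) (inj₁ q) = lookup-injective edges-unique e f (trans p (sym q))
    go (inj₂ p) (inj₂ q) = lookup-injective edges-unique e f (trans p (sym q))
    go (inj₁ p) (inj₂ q) = contradiction (increasing {f} q) (ℕ.<-asym (increasing {e} p))
    go (inj₂ p) (inj₁ q) = contradiction (increasing {f} q) (ℕ.<-asym (increasing {e} p))

  joins-self : ∀ e → Joins e (proj₁ (lookup (edges G) e)) (proj₂ (lookup (edges G) e))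
  joins-self e = inj₁ refl

  joins⇒incident : ∀ {e u v} → Joins e u v → Incident G u e
  joins⇒incident (inj₁ p) = inj₁ (sym (cong proj₁ p))
  joins⇒incident (inj₂ p) = inj₂ (sym (cong proj₂ p))

  incident⇒joins : ∀ {e u} → Incident G u e → ∃[ v ] Joins e u v
  incident⇒joins (inj₁ refl) = _ , inj₁ refl
  incident⇒joins (inj₂ refl) = _ , inj₂ refl

  Matched : EdgeSet G → V → V → Set
  Matched M u v = ∃[ e ] (e ∈ M × Joins e u v)

  Covered : EdgeSet G → V → Set
  Covered M u = ∃[ v ] Matched M u v

  module _ {M : EdgeSet G} where

    matched-sym : ∀ {u v} → Matched M u v → Matched M v u
    matched-sym (e , e∈ , j) = e , e∈ , joins-sym j

    matched⇒adj : ∀ {u v} → Matched M u v → Adj G u v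
    matched⇒adj (_ , _ , j) = joins⇒adj j

    coveredˡ : ∀ {u v} → Matched M u v → Covered M u
    coveredˡ m = _ , m

    coveredʳ : ∀ {u v} → Matched M u v → Covered M v
    coveredʳ m = _ , matched-sym m

    mate-unique : IsMatching G M → ∀ {u v w} → Matched M u v → Matched M u w → v ≡ w
    mate-unique mat {u} (e , e∈ , j) (f , f∈ , k) with e ≟ f
    ... | no e≢f = contradiction (joins⇒incident j , joins⇒incident k) (mat e f e∈ f∈ e≢f u)
    ... | yes refl with joins-ends j k
    ... | inj₁ (_ , v≡w)    = v≡w
    ... | inj₂ (u≡w , v≡u) = trans v≡u u≡w

  ends : EdgeSet G → List V
  ends M = map (proj₁ ∘ lookup (edges G)) (elements M) ++ map (proj₂ ∘ lookup (edges G)) (elements M)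

  length-ends : ∀ M → length (ends M) ≡ ∣ M ∣ + ∣ M ∣
  length-ends M = trans (length-++ (map (proj₁ ∘ lookup (edges G)) (elements M)))
    (cong₂ _+_ (trans (length-map _ (elements M)) (length-elements M))
               (trans (length-map _ (elements M)) (length-elements M)))

  covered⇒∈ends : ∀ {M u} → Covered M u → u ∈ₗ ends M
  covered⇒∈ends (_ , e , e∈ , j) with joins⇒incident j
  ... | inj₁ refl = ∈-++⁺ˡ (∈-map⁺ _ (∈-elements⁺ e∈))
  ... | inj₂ refl = ∈-++⁺ʳ _ (∈-map⁺ _ (∈-elements⁺ e∈))

  ∈ends⇒covered : ∀ {M u} → u ∈ₗ ends M → Covered M u
  ∈ends⇒covered {M} u∈ with ∈-++⁻ (map (proj₁ ∘ lookup (edges G)) (elements M)) u∈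
  ... | inj₁ p with ∈-map⁻ _ p
  ...   | e , e∈ , refl = _ , e , ∈-elements⁻ e∈ , inj₁ refl
  ∈ends⇒covered {M} u∈ | inj₂ p with ∈-map⁻ _ p
  ...   | e , e∈ , refl = _ , e , ∈-elements⁻ e∈ , inj₂ refl

  covered? : ∀ M u → Dec (Covered M u)
  covered? M u = map′ ∈ends⇒covered covered⇒∈ends (u ∈ₗ? ends M)

  covered-≤ : ∀ {M us} → Unique us → All (Covered M) us → length us ≤ ∣ M ∣ + ∣ M ∣
  covered-≤ {M} {us} us! cov = subst (length us ≤_) (length-ends M)
    (unique-⊆⇒≤ us! (λ u∈ → covered⇒∈ends {M} (All.lookup cov u∈)))

  add-edge : ∀ {M e u v} → IsMatching G M → Joins e u v → ¬ Covered M u → ¬ Covered M v →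
    IsMatching G (M ∪ ⁅ e ⁆)
  add-edge {M} {e} {u} {v} mat j u∉ v∉ = go
    where
    clash : ∀ {f w} → f ∈ M → Incident G w f → ¬ Incident G w e
    clash f∈M wf we with incident⇒joins wf | incident⇒joins we
    ... | _ , jf | _ , je with joins-ends je j
    ... | inj₁ (refl , _) = u∉ (_ , _ , f∈M , jf)
    ... | inj₂ (refl , _) = v∉ (_ , _ , f∈M , jf)
    go : IsMatching G (M ∪ ⁅ e ⁆)
    go f g f∈ g∈ f≢g w (wf , wg) with x∈p∪q⁻ M ⁅ e ⁆ f∈ | x∈p∪q⁻ M ⁅ e ⁆ g∈
    ... | inj₁ f∈M | inj₁ g∈M = mat f g f∈M g∈M f≢g w (wf , wg)
    ... | inj₂ f∈e | inj₂ g∈e = f≢g (trans (x∈⁅y⁆⇒x≡y e f∈e) (sym (x∈⁅y⁆⇒x≡y e g∈e)))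
    ... | inj₁ f∈M | inj₂ g∈e with refl ← x∈⁅y⁆⇒x≡y e g∈e = clash f∈M wf wg
    ... | inj₂ f∈e | inj₁ g∈M with refl ← x∈⁅y⁆⇒x≡y e f∈e = clash g∈M wg wf

  -- If both ends were free, the edge could be added to `M`. Most uses of maximality take this form:
  -- the covered vertices meet every edge.
  maximal⇒covers : ∀ {M} → IsMaximalMatching G M → ∀ {u v} → Adj G u v → Covered M u ⊎ Covered M v
  maximal⇒covers {M} (mat , max) {u} {v} uv with covered? M u | covered? M v
  ... | yes c | _     = inj₁ c
  ... | no _  | yes c = inj₂ c
  ... | no u∉ | no v∉ with adj⇒joins uv
  ... | e , j = ⊥-elim (max
    (M ∪ ⁅ e ⁆ , add-edge mat j u∉ v∉ , (λ x∈ → x∈p∪q⁺ (inj₁ x∈)) ,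
     e , x∈p∪q⁺ (inj₂ (x∈⁅x⁆ e)) , λ e∈ → u∉ (v , e , e∈ , j)))

  extend : ∀ M → IsMatching G M → ∃[ N ] (IsMaximalMatching G N × M ⊆ N)
  extend M = go M (⊃-wellFounded M)
    where
    go : ∀ M → Acc (λ N M → M ⊂ N) M → IsMatching G M → ∃[ N ] (IsMaximalMatching G N × M ⊆ N)
    go M (acc rec) m with anySubset? (λ N → isMatching? G N ×-dec (M ⊂? N))
    ... | no  none          = M , (m , none) , id
    ... | yes (N , n , M⊂N) with go N (rec M⊂N) n
    ... | N′ , max , N⊆N′ = N′ , max , λ x∈ → N⊆N′ (proj₁ M⊂N x∈)

  maximal-⊆⇒≡ : ∀ {M N} → IsMaximalMatching G M → IsMatching G N → M ⊆ N → M ≡ N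
  maximal-⊆⇒≡ {M} {N} (_ , max) n M⊆N = ⊆-antisym M⊆N λ {x} x∈ →
    decidable-stable (x ∈? M) λ x∉ → max (N , n , M⊆N , x , x∈ , x∉)

  endpoints : List (V × V) → List V
  endpoints []            = []
  endpoints ((u , v) ∷ P) = u ∷ v ∷ endpoints P

  -- Concrete matchings are written as lists of vertex pairs, without positions in the edge list;
  -- `Contains` relates such a list to an `EdgeSet`.
  data Disjoint : List (V × V) → Set where
    []  : Disjoint []
    add : ∀ {u v P} → Adj G u v → All (u ≢_) (endpoints P) → All (v ≢_) (endpoints P) →
          Disjoint P → Disjoint ((u , v) ∷ P)

  disjoint⇒unique : ∀ {P} → Disjoint P → Unique (endpoints P)
  disjoint⇒unique []             = []
  disjoint⇒unique (add uv p q d) = (adj⇒≢ uv ∷ p) ∷ q ∷ disjoint⇒unique d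

  length-endpoints : ∀ P → length (endpoints P) ≡ length P + length P
  length-endpoints []      = refl
  length-endpoints (_ ∷ P) = cong suc (trans (cong suc (length-endpoints P)) (sym (ℕ.+-suc _ _)))

  Contains : EdgeSet G → List (V × V) → Set
  Contains M P = All (λ (u , v) → Matched M u v) P

  contains⇒covered : ∀ {M P} → Contains M P → All (Covered M) (endpoints P)
  contains⇒covered []      = []
  contains⇒covered {M} (m ∷ c) = coveredˡ {M} m ∷ coveredʳ {M} m ∷ contains⇒covered c

  contains-≤ : ∀ {M P} → Disjoint P → Contains M P → length P ≤ ∣ M ∣
  contains-≤ {M} {P} d c = halve (subst (_≤ ∣ M ∣ + ∣ M ∣) (length-endpoints P)
    (covered-≤ (disjoint⇒unique d) (contains⇒covered c)))
    where
    halve : ∀ {a b} → a + a ≤ b + b → a ≤ b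
    halve {a} {b} p with a ≤? b
    ... | yes a≤b = a≤b
    ... | no  a≰b = contradiction (ℕ.+-mono-< (ℕ.≰⇒> a≰b) (ℕ.≰⇒> a≰b)) (ℕ.≤⇒≯ p)

  disjoint⇒matching : ∀ {P} → Disjoint P →
    ∃[ M ] (IsMatching G M × Contains M P × (∀ {w} → Covered M w → w ∈ₗ endpoints P))
  disjoint⇒matching [] = ∅ , (λ e f e∈ → contradiction e∈ ∉⊥) , [] , λ (_ , _ , e∈ , _) → contradiction e∈ ∉⊥
  disjoint⇒matching (add uv p q d) with disjoint⇒matching d | adj⇒joins uv
  ... | M , mat , c , cov | e , j =
    M ∪ ⁅ e ⁆ ,
    add-edge mat j (λ u∈ → All.lookup p (cov u∈) refl) (λ v∈ → All.lookup q (cov v∈) refl) ,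
    (e , x∈p∪q⁺ (inj₂ (x∈⁅x⁆ e)) , j) ∷ All.map (λ (f , f∈ , k) → f , x∈p∪q⁺ (inj₁ f∈) , k) c ,
    λ (w′ , f , f∈ , k) → case x∈p∪q⁻ M ⁅ e ⁆ f∈ of λ where
      (inj₁ f∈M) → there (there (cov (w′ , f , f∈M , k)))
      (inj₂ f∈e) → case x∈⁅y⁆⇒x≡y e f∈e of λ where
        refl → case joins-ends k j of λ where
          (inj₁ (refl , _)) → here refl
          (inj₂ (refl , _)) → there (here refl)

  disjoint⇒maximal : ∀ {P} → Disjoint P → ∃[ M ] (IsMaximalMatching G M × Contains M P)
  disjoint⇒maximal d with disjoint⇒matching d
  ... | M , mat , c , _ with extend M mat
  ... | N , max , M⊆N = N , max , All.map (λ (f , f∈ , k) → f , M⊆N f∈ , k) c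

  -- P is itself a maximal matching, so that P ⊆ M forces M = P.
  Dominating : List (V × V) → Set
  Dominating P = ∀ {u v} → Adj G u v → u ∈ₗ endpoints P ⊎ v ∈ₗ endpoints P

  ∈-endpoints⁻ : ∀ {u P} → u ∈ₗ endpoints P → ∃[ w ] ((u , w) ∈ₗ P ⊎ (w , u) ∈ₗ P)
  ∈-endpoints⁻ {P = _ ∷ _} (here refl)         = _ , inj₁ (here refl)
  ∈-endpoints⁻ {P = _ ∷ _} (there (here refl)) = _ , inj₂ (here refl)
  ∈-endpoints⁻ {P = _ ∷ _} (there (there u∈)) with ∈-endpoints⁻ u∈
  ... | w , inj₁ p = w , inj₁ (there p)
  ... | w , inj₂ p = w , inj₂ (there p)

  -- One end of the edge is an endpoint of `P`, and there the mate under `M` is already prescribed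
  -- by `P`.
  dominated : ∀ {M P} → Dominating P → IsMatching G M → Contains M P →
    ∀ {e} → e ∈ M → ∃[ x ] (x ∈ₗ P × Joins e (proj₁ x) (proj₂ x))
  dominated {M} {P} dom mat c {e} e∈ = case dom (joins⇒adj (joins-self e)) of λ where
      (inj₁ u∈) → from u∈ (joins-self e)
      (inj₂ v∈) → from v∈ (joins-sym (joins-self e))
    where
    from : ∀ {u v} → u ∈ₗ endpoints P → Joins e u v → ∃[ x ] (x ∈ₗ P × Joins e (proj₁ x) (proj₂ x))
    from u∈ j with ∈-endpoints⁻ u∈
    ... | w , inj₁ p with refl ← mate-unique {M} mat (e , e∈ , j) (All.lookup c p) = _ , p , j
    ... | w , inj₂ p with refl ← mate-unique {M} mat (e , e∈ , j) (matched-sym {M} (All.lookup c p)) =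
      _ , p , joins-sym j

  dominating-≤ : ∀ {M P} → Dominating P → IsMatching G M → Contains M P → ∣ M ∣ ≤ length P
  dominating-≤ {M} {P} dom mat c = subst (_≤ length P) (length-elements M)
    (pigeonhole (λ e x → Joins e (proj₁ x) (proj₂ x)) joins-unique (elements-unique M)
      (λ e∈ → dominated dom mat c (∈-elements⁻ e∈)))

  dominating-≡ : ∀ {M N P} → Dominating P → IsMaximalMatching G M → IsMaximalMatching G N →
    Contains M P → Contains N P → M ≡ N
  dominating-≡ {M} {N} dom max max′ c c′ = maximal-⊆⇒≡ max (proj₁ max′) λ e∈ →
    case dominated dom (proj₁ max) c e∈ of λ where
      (x , x∈ , j) → case All.lookup c′ x∈ of λ where
        (f , f∈ , k) → subst (_∈ N) (joins-unique k j) f∈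

  maximalMatchings-unique : Unique (maximalMatchings G)
  maximalMatchings-unique = Unique.filter⁺ (isMaximalMatching? G) (allSubsets-unique (#edges G))

  ∈-maximalMatchings⁺ : ∀ {M} → IsMaximalMatching G M → M ∈ₗ maximalMatchings G
  ∈-maximalMatchings⁺ {M} max = ∈-filter⁺ (isMaximalMatching? G) (∈-allSubsets M) max

  ∈-maximalMatchings⁻ : ∀ {M} → M ∈ₗ maximalMatchings G → IsMaximalMatching G M
  ∈-maximalMatchings⁻ M∈ = proj₂ (∈-filter⁻ (isMaximalMatching? G) {xs = allSubsets (#edges G)} M∈)

  withSize2 : List (EdgeSet G)
  withSize2 = filter (λ M → ∣ M ∣ ℕ.≟ 2) (maximalMatchings G)

  withSize≥ : ℕ → List (EdgeSet G)
  withSize≥ m = filter (λ M → m ≤? ∣ M ∣) (maximalMatchings G)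

  -- Every `P i` extends to a maximal matching, and by the separation hypothesis this extension
  -- contains no other member of the family, so it determines `i`.
  family-≤ : ∀ {I : Set} {is : List I} (m : ℕ) (P : I → List (V × V)) → Unique is →
    (∀ {i} → i ∈ₗ is → Disjoint (P i) × m ≤ length (P i)) →
    (∀ {i j M} → i ∈ₗ is → j ∈ₗ is → IsMatching G M → Contains M (P i) → Contains M (P j) → i ≡ j) →
    length is ≤ length (withSize≥ m)
  family-≤ {is = is} m P is! valid sep = pigeonhole (λ i M → i ∈ₗ is × IsMatching G M × Contains M (P i))
    (λ (i∈ , mat , c) (j∈ , _ , c′) → sep i∈ j∈ mat c c′) is! λ i∈ →
      case disjoint⇒maximal (proj₁ (valid i∈)) of λ where
        (M , max , c) → M ,
          ∈-filter⁺ (λ M → m ≤? ∣ M ∣) (∈-maximalMatchings⁺ max)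
            (ℕ.≤-trans (proj₂ (valid i∈)) (contains-≤ (proj₁ (valid i∈)) c)) ,
          i∈ , proj₁ max , c

-- From the numbers of matchings of each size to averages.

module _ {A : Set} (f : A → ℕ) where

  private
    #2 #≥3 #≥4 : List A → ℕ
    #2  xs = length (filter (λ x → f x ℕ.≟ 2) xs)
    #≥3 xs = length (filter (λ x → 3 ≤? f x) xs)
    #≥4 xs = length (filter (λ x → 4 ≤? f x) xs)

  length-by-size : ∀ xs → All (λ x → 2 ≤ f x) xs → length xs ≡ #2 xs + #≥3 xs
  length-by-size []       []       = refl
  length-by-size (x ∷ xs) (p ∷ ps) with f x
  ... | 1                         = contradiction p λ { (s≤s ()) }
  ... | 2                         = cong suc (length-by-size xs ps)
  ... | 3                         = trans (cong suc (length-by-size xs ps)) (sym (ℕ.+-suc _ _))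
  ... | suc (suc (suc (suc _))) = trans (cong suc (length-by-size xs ps)) (sym (ℕ.+-suc _ _))

  -- Elements of size at least 4 are counted among those of size at least 3 as well, hence they
  -- contribute 3 there and only 1 more here.
  sum-by-size-≥ : ∀ xs → All (λ x → 2 ≤ f x) xs → 2 * #2 xs + 3 * #≥3 xs + #≥4 xs ≤ sum (map f xs)
  sum-by-size-≥ []       []       = z≤n
  sum-by-size-≥ (x ∷ xs) (p ∷ ps) with f x
  ... | 1 = contradiction p λ { (s≤s ()) }
  ... | 2 = ℕ.≤-trans (ℕ.≤-reflexive
      (solve 3 (λ a b c → con 2 :* (con 1 :+ a) :+ con 3 :* b :+ c
                       := con 2 :+ (con 2 :* a :+ con 3 :* b :+ c)) refl (#2 xs) (#≥3 xs) (#≥4 xs)))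
      (ℕ.+-monoʳ-≤ 2 (sum-by-size-≥ xs ps))
    where open +-*-Solver
  ... | 3 = ℕ.≤-trans (ℕ.≤-reflexive
      (solve 3 (λ a b c → con 2 :* a :+ con 3 :* (con 1 :+ b) :+ c
                       := con 3 :+ (con 2 :* a :+ con 3 :* b :+ c)) refl (#2 xs) (#≥3 xs) (#≥4 xs)))
      (ℕ.+-monoʳ-≤ 3 (sum-by-size-≥ xs ps))
    where open +-*-Solver
  ... | suc (suc (suc (suc m))) = ℕ.≤-trans (ℕ.≤-reflexive
      (solve 3 (λ a b c → con 2 :* a :+ con 3 :* (con 1 :+ b) :+ (con 1 :+ c)
                       := con 4 :+ (con 2 :* a :+ con 3 :* b :+ c)) refl (#2 xs) (#≥3 xs) (#≥4 xs)))
      (ℕ.+-mono-≤ (ℕ.m≤m+n 4 m) (sum-by-size-≥ xs ps))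
    where open +-*-Solver

  sum-by-size-≤ : ∀ xs → All (λ x → f x ≤ 3) xs → sum (map f xs) + #2 xs ≤ 3 * length xs
  sum-by-size-≤ []       []       = z≤n
  sum-by-size-≤ (x ∷ xs) (p ∷ ps) with f x
  ... | 0 = ℕ.≤-trans (sum-by-size-≤ xs ps) (ℕ.*-monoʳ-≤ 3 (ℕ.n≤1+n (length xs)))
  ... | 1 = ℕ.≤-trans (ℕ.+-mono-≤ (s≤s (z≤n {2})) (sum-by-size-≤ xs ps))
      (ℕ.≤-reflexive (sym (ℕ.*-suc 3 (length xs))))
  ... | 2 = ℕ.≤-trans (ℕ.≤-reflexive
      (solve 2 (λ s a → con 2 :+ s :+ (con 1 :+ a) := con 3 :+ (s :+ a)) refl (sum (map f xs)) (#2 xs)))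
      (ℕ.≤-trans (ℕ.+-monoʳ-≤ 3 (sum-by-size-≤ xs ps)) (ℕ.≤-reflexive (sym (ℕ.*-suc 3 (length xs)))))
    where open +-*-Solver
  ... | 3 = ℕ.≤-trans (ℕ.+-monoʳ-≤ 3 (sum-by-size-≤ xs ps))
      (ℕ.≤-reflexive (sym (ℕ.*-suc 3 (length xs))))
  ... | suc (suc (suc (suc _))) = contradiction p λ { (s≤s (s≤s (s≤s ()))) }

frac-< : ∀ a b c d .{{_ : NonZero b}} .{{_ : NonZero d}} → a * d < c * b →
  (+ a ℚ./ b) ℚ.< (+ c ℚ./ d)
frac-< a (suc b) c (suc d) lt = ℚ.toℚᵘ-cancel-<
  (ℚᵘ.<-respˡ-≃ (ℚᵘ.≃-sym (ℚ.toℚᵘ-fromℚᵘ (ℚᵘ.mkℚᵘ (+ a) b)))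
  (ℚᵘ.<-respʳ-≃ (ℚᵘ.≃-sym (ℚ.toℚᵘ-fromℚᵘ (ℚᵘ.mkℚᵘ (+ c) d)))
  (ℚᵘ.*<* (subst₂ ℤ._<_ (ℤ.pos-* a (suc d)) (ℤ.pos-* c (suc b)) (ℤ.+<+ lt)))))

#maximal : ∀ {n} → Graph n → ℕ
#maximal G = length (maximalMatchings G)

totalSize : ∀ {n} → Graph n → ℕ
totalSize G = sum (map ∣_∣ (maximalMatchings G))

-- The fraction y/x separates the two averages. Multiplying each bound by the other graph's count
-- gives the cross-multiplied inequality times `x`, which is then cancelled.
avm-<-via : ∀ {n} (G H : Graph n) (x y : ℕ) .{{_ : NonZero x}} →
  x * totalSize G ≤ y * #maximal G → y * #maximal H < x * totalSize H → avm G ℚ.< avm H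
avm-<-via G H x y g h = frac-< s l s′ l′ (ℕ.*-cancelˡ-< x _ _ (begin-strict
  x * (s * l′)   ≡⟨ ℕ.*-assoc x s l′ ⟨
  x * s * l′     ≤⟨ ℕ.*-monoˡ-≤ l′ g ⟩
  y * l * l′     ≡⟨ solve 3 (λ y l l′ → y :* l :* l′ := y :* l′ :* l) refl y l l′ ⟩
  y * l′ * l     <⟨ ℕ.*-monoˡ-< l h ⟩
  x * s′ * l     ≡⟨ ℕ.*-assoc x s′ l ⟩
  x * (s′ * l)   ∎))
  where
  open ℕ.≤-Reasoning
  open +-*-Solver
  s  = totalSize G
  l  = #maximal G
  s′ = totalSize H
  l′ = #maximal H
  instance
    l≢0 : NonZero l
    l≢0 = #maximalMatchings-nonZero G
    l′≢0 : NonZero l′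
    l′≢0 = #maximalMatchings-nonZero H

-- avm(T_n^1(3,3)) = (9k + 15)/(3k + 7) with k = n − 6 leaves.
avm-upper : ∀ {n} (G : Graph n) (k : ℕ) → All (λ M → ∣ M ∣ ≤ 3) (maximalMatchings G) →
  #maximal G ≤ 3 * k + 7 → 6 ≤ length (withSize2 G) →
  (3 * k + 7) * totalSize G ≤ (9 * k + 15) * #maximal G
avm-upper G k ≤3 l≤ 6≤c = ℕ.+-cancelʳ-≤ (x * c) _ _ (begin
  x * s + x * c               ≡⟨ ℕ.*-distribˡ-+ x s c ⟨
  x * (s + c)                 ≤⟨ ℕ.*-monoʳ-≤ x (sum-by-size-≤ ∣_∣ (maximalMatchings G) ≤3) ⟩
  x * (3 * l)                 ≡⟨ solve 2 (λ k l → (con 3 :* k :+ con 7) :* (con 3 :* l)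
                                    := (con 9 :* k :+ con 15) :* l :+ l :* con 6) refl k l ⟩
  (9 * k + 15) * l + l * 6    ≤⟨ ℕ.+-monoʳ-≤ ((9 * k + 15) * l) (ℕ.*-mono-≤ l≤ 6≤c) ⟩
  (9 * k + 15) * l + x * c    ∎)
  where
  open ℕ.≤-Reasoning
  open +-*-Solver
  x = 3 * k + 7
  s = totalSize G
  l = #maximal G
  c = length (withSize2 G)

-- With x = 3k + 7 one has 9k + 15 = 3x - 6, and the total size is at least 2a + 3b + c. The
-- difference of the two sides is therefore at least 6b + xc - (x - 6)a, where x - 6 = 3k + 1.
avm-lower : ∀ {n} (G : Graph n) (k : ℕ) → All (λ M → 2 ≤ ∣ M ∣) (maximalMatchings G) →
  (3 * k + 1) * length (withSize2 G) < 6 * length (withSize≥ G 3) + (3 * k + 7) * length (withSize≥ G 4) →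
  (9 * k + 15) * #maximal G < (3 * k + 7) * totalSize G
avm-lower G k ≥2 lt = begin-strict
  (9 * k + 15) * #maximal G
    ≡⟨ cong ((9 * k + 15) *_) (length-by-size ∣_∣ (maximalMatchings G) ≥2) ⟩
  (9 * k + 15) * (a + b)
    ≡⟨ solve 3 (λ k a b → (con 9 :* k :+ con 15) :* (a :+ b)
          := (con 6 :* k :+ con 14) :* a :+ (con 9 :* k :+ con 15) :* b :+ (con 3 :* k :+ con 1) :* a)
        refl k a b ⟩
  (6 * k + 14) * a + (9 * k + 15) * b + (3 * k + 1) * a
    <⟨ ℕ.+-monoʳ-< ((6 * k + 14) * a + (9 * k + 15) * b) lt ⟩
  (6 * k + 14) * a + (9 * k + 15) * b + (6 * b + (3 * k + 7) * c)
    ≡⟨ solve 4 (λ k a b c → (con 6 :* k :+ con 14) :* a :+ (con 9 :* k :+ con 15) :* b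
             :+ (con 6 :* b :+ (con 3 :* k :+ con 7) :* c)
          := (con 3 :* k :+ con 7) :* (con 2 :* a :+ con 3 :* b :+ c)) refl k a b c ⟩
  (3 * k + 7) * (2 * a + 3 * b + c)
    ≤⟨ ℕ.*-monoʳ-≤ (3 * k + 7) (sum-by-size-≥ ∣_∣ (maximalMatchings G) ≥2) ⟩
  (3 * k + 7) * totalSize G ∎
  where
  open ℕ.≤-Reasoning
  open +-*-Solver
  a = length (withSize2 G)
  b = length (withSize≥ G 3)
  c = length (withSize≥ G 4)

-- Triangles and their sides.

nxt prv : Fin 3 → Fin 3
nxt 0F = 1F
nxt 1F = 2F
nxt 2F = 0F
prv 0F = 2F
prv 1F = 0F
prv 2F = 1F

nxt≢ : ∀ i → nxt i ≢ i
nxt≢ = from-yes (all? λ i → ¬? (nxt i ≟ i))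

prv≢ : ∀ i → prv i ≢ i
prv≢ = from-yes (all? λ i → ¬? (prv i ≟ i))

nxt≢prv : ∀ i → nxt i ≢ prv i
nxt≢prv = from-yes (all? λ i → ¬? (nxt i ≟ prv i))

≢⇒nxt⊎prv : ∀ i j → j ≢ i → j ≡ nxt i ⊎ j ≡ prv i
≢⇒nxt⊎prv i j j≢i = [ (λ j≡i → contradiction j≡i j≢i) , id ]′ (decide i j)
  where
  decide : ∀ i j → j ≡ i ⊎ (j ≡ nxt i ⊎ j ≡ prv i)
  decide = from-yes (all? λ i → all? λ j → (j ≟ i) ⊎-dec ((j ≟ nxt i) ⊎-dec (j ≟ prv i)))

third : ∀ i j → i ≢ j → ∃[ x ] ((i ≡ nxt x × j ≡ prv x) ⊎ (i ≡ prv x × j ≡ nxt x))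
third i j i≢j = [ (λ i≡j → contradiction i≡j i≢j) , id ]′ (decide i j)
  where
  decide : ∀ i j → i ≡ j ⊎ ∃[ x ] ((i ≡ nxt x × j ≡ prv x) ⊎ (i ≡ prv x × j ≡ nxt x))
  decide = from-yes (all? λ i → all? λ j → (i ≟ j) ⊎-dec any? λ x →
    ((i ≟ nxt x) ×-dec (j ≟ prv x)) ⊎-dec ((i ≟ prv x) ×-dec (j ≟ nxt x)))

-- The side opposite the vertex `t x`. Naming a side by its opposite vertex keeps the vertex that a
-- matching leaves over in view.
opp : ∀ {n} → (Fin 3 → Fin n) → Fin 3 → Fin n × Fin n
opp t x = t (nxt x) , t (prv x)

module _ {n : ℕ} (G : Graph n) where

  Triangle : (Fin 3 → Fin n) → Set
  Triangle t = ∀ {i j} → i ≢ j → Adj G (t i) (t j)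

  triangle-≢ : ∀ {t} → Triangle t → ∀ {i j} → i ≢ j → t i ≢ t j
  triangle-≢ tri i≢j = adj⇒≢ G (tri i≢j)

  triangle-injective : ∀ {t} → Triangle t → ∀ {i j} → t i ≡ t j → i ≡ j
  triangle-injective tri {i} {j} eq = decidable-stable (i ≟ j) λ i≢j → triangle-≢ tri i≢j eq

  opp-mate : ∀ {M} (t : Fin 3 → Fin n) {x} → Matched G M (t (nxt x)) (t (prv x)) →
    ∀ i → i ≢ x → ∃[ j ] (j ≢ i × j ≢ x × Matched G M (t i) (t j))
  opp-mate {M} t {x} m i i≢x with ≢⇒nxt⊎prv x i i≢x
  ... | inj₁ refl = prv x , ≢-sym (nxt≢prv x) , prv≢ x , m
  ... | inj₂ refl = nxt x , nxt≢prv x , nxt≢ x , matched-sym G {M} m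

  -- Different sides share a vertex, which would have two mates: `t y` lies on the side opposite
  -- `t x`, and its mate there is already matched along the side opposite `t y`.
  opp-separates : ∀ {M t} → Triangle t → IsMatching G M → ∀ {x y} →
    Matched G M (t (nxt x)) (t (prv x)) → Matched G M (t (nxt y)) (t (prv y)) → x ≡ y
  opp-separates {M} {t} tri mat {x} {y} m m′ = decidable-stable (x ≟ y) λ x≢y →
    case opp-mate {M} t m y (≢-sym x≢y) of λ where
      (j , j≢y , _ , yj) → case opp-mate {M} t m′ j j≢y of λ where
        (k , k≢j , k≢y , jk) → k≢y (triangle-injective tri
          (mate-unique G {M} mat jk (matched-sym G {M} yj)))

-- The maximal matchings of T_n^1(3,3).

-- Stated for any graph with the adjacency table of T¹₃₃, so that its edge sets stay abstract.
module _ (k : ℕ) (T₃₃ : Graph (6 + k))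
  (table : ∀ u v → Graph.adj T₃₃ u v ≡ Graph.adj (T¹₃₃ (6 + k)) u v) where

  private
    V : Set
    V = Fin (6 + k)

    Edge : V → V → Set
    Edge = Adj (T¹₃₃ (6 + k))

    adj⇒edge : ∀ {u v} → Adj T₃₃ u v → Edge u v
    adj⇒edge {u} {v} = subst T (table u v)

    edge⇒adj : ∀ {u v} → Edge u v → Adj T₃₃ u v
    edge⇒adj {u} {v} = subst T (sym (table u v))

    matched⇒edge : ∀ {M u v} → Matched T₃₃ M u v → Edge u v
    matched⇒edge {M} m = adj⇒edge (matched⇒adj T₃₃ {M} m)

    leaf : Fin k → V
    leaf l = suc (suc (suc (suc (suc (suc l)))))

    v : Fin 2 → V
    v 0F = 0F
    v 1F = 1F

    w : Fin 3 → V
    w 0F = 3F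
    w 1F = 4F
    w 2F = 5F

    v-injective : ∀ {c c′} → v c ≡ v c′ → c ≡ c′
    v-injective {0F} {0F} _ = refl
    v-injective {0F} {1F} ()
    v-injective {1F} {0F} ()
    v-injective {1F} {1F} _ = refl

    w-triangle : Triangle T₃₃ w
    w-triangle {0F} {0F} i≢j = contradiction refl i≢j
    w-triangle {0F} {1F} _   = edge⇒adj {w 0F} {w 1F} tt
    w-triangle {0F} {2F} _   = edge⇒adj {w 0F} {w 2F} tt
    w-triangle {1F} {0F} _   = edge⇒adj {w 1F} {w 0F} tt
    w-triangle {1F} {1F} i≢j = contradiction refl i≢j
    w-triangle {1F} {2F} _   = edge⇒adj {w 1F} {w 2F} tt
    w-triangle {2F} {0F} _   = edge⇒adj {w 2F} {w 0F} tt
    w-triangle {2F} {1F} _   = edge⇒adj {w 2F} {w 1F} tt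
    w-triangle {2F} {2F} i≢j = contradiction refl i≢j

    2≢w : ∀ i → 2F ≢ w i
    2≢w 0F ()
    2≢w 1F ()
    2≢w 2F ()

    v≢w : ∀ c i → v c ≢ w i
    v≢w 0F 0F ()
    v≢w 0F 1F ()
    v≢w 0F 2F ()
    v≢w 1F 0F ()
    v≢w 1F 1F ()
    v≢w 1F 2F ()

    2-v : ∀ c → Edge 2F (v c)
    2-v 0F = tt
    2-v 1F = tt

    nbr-0 : ∀ x → Edge 0F x → x ≡ 1F ⊎ x ≡ 2F
    nbr-0 1F _ = inj₁ refl
    nbr-0 2F _ = inj₂ refl
    nbr-0 0F ()
    nbr-0 3F ()
    nbr-0 4F ()
    nbr-0 5F ()
    nbr-0 (suc (suc (suc (suc (suc (suc _)))))) ()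

    nbr-1 : ∀ x → Edge 1F x → x ≡ 0F ⊎ x ≡ 2F
    nbr-1 0F _ = inj₁ refl
    nbr-1 2F _ = inj₂ refl
    nbr-1 1F ()
    nbr-1 3F ()
    nbr-1 4F ()
    nbr-1 5F ()
    nbr-1 (suc (suc (suc (suc (suc (suc _)))))) ()

    nbr-2 : ∀ x → Edge 2F x → ∃[ c ] x ≡ v c ⊎ x ≡ 3F ⊎ ∃[ l ] x ≡ leaf l
    nbr-2 0F _ = inj₁ (0F , refl)
    nbr-2 1F _ = inj₁ (1F , refl)
    nbr-2 3F _ = inj₂ (inj₁ refl)
    nbr-2 (suc (suc (suc (suc (suc (suc l)))))) _ = inj₂ (inj₂ (l , refl))
    nbr-2 2F ()
    nbr-2 4F ()
    nbr-2 5F ()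

    nbr-3 : ∀ x → Edge 3F x → x ≡ 2F ⊎ x ≡ 4F ⊎ x ≡ 5F
    nbr-3 2F _ = inj₁ refl
    nbr-3 4F _ = inj₂ (inj₁ refl)
    nbr-3 5F _ = inj₂ (inj₂ refl)
    nbr-3 0F ()
    nbr-3 1F ()
    nbr-3 3F ()
    nbr-3 (suc (suc (suc (suc (suc (suc _)))))) ()

    nbr-4 : ∀ x → Edge 4F x → x ≡ 3F ⊎ x ≡ 5F
    nbr-4 3F _ = inj₁ refl
    nbr-4 5F _ = inj₂ refl
    nbr-4 0F ()
    nbr-4 1F ()
    nbr-4 2F ()
    nbr-4 4F ()
    nbr-4 (suc (suc (suc (suc (suc (suc _)))))) ()

    nbr-5 : ∀ x → Edge 5F x → x ≡ 3F ⊎ x ≡ 4F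
    nbr-5 3F _ = inj₁ refl
    nbr-5 4F _ = inj₂ refl
    nbr-5 0F ()
    nbr-5 1F ()
    nbr-5 2F ()
    nbr-5 5F ()
    nbr-5 (suc (suc (suc (suc (suc (suc _)))))) ()

    nbr-leaf : ∀ l x → Edge (leaf l) x → x ≡ 2F
    nbr-leaf l 2F _ = refl
    nbr-leaf l 0F ()
    nbr-leaf l 1F ()
    nbr-leaf l 3F ()
    nbr-leaf l 4F ()
    nbr-leaf l 5F ()
    nbr-leaf l (suc (suc (suc (suc (suc (suc _)))))) ()

    nbr-w : ∀ i x → Edge (w i) x → x ≡ 2F ⊎ ∃[ j ] (j ≢ i × x ≡ w j)
    nbr-w 0F x e with nbr-3 x e
    ... | inj₁ p        = inj₁ p
    ... | inj₂ (inj₁ p) = inj₂ (1F , (λ ()) , p)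
    ... | inj₂ (inj₂ p) = inj₂ (2F , (λ ()) , p)
    nbr-w 1F x e with nbr-4 x e
    ... | inj₁ p = inj₂ (0F , (λ ()) , p)
    ... | inj₂ p = inj₂ (2F , (λ ()) , p)
    nbr-w 2F x e with nbr-5 x e
    ... | inj₁ p = inj₂ (0F , (λ ()) , p)
    ... | inj₂ p = inj₂ (1F , (λ ()) , p)

    -- Apart from `w y`, one vertex among v₁, v₂ and the leaves, the required vertices form a vertex
    -- cover: a leaf sees only the hub v₃, and `w y` sees only the hub and the other two `w i`. The
    -- edge v₁v₂ is met by whichever of its ends is present.
    dominating : ∀ {P} y → 2F ∈ₗ endpoints T₃₃ P → 0F ∈ₗ endpoints T₃₃ P ⊎ 1F ∈ₗ endpoints T₃₃ P →
      (∀ i → i ≢ y → w i ∈ₗ endpoints T₃₃ P) → Dominating T₃₃ P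
    dominating {P} y 2∈ 01∈ w∈ {a} {b} ab = go a b (adj⇒edge ab)
      where
      Hit : V → V → Set
      Hit a b = a ∈ₗ endpoints T₃₃ P ⊎ b ∈ₗ endpoints T₃₃ P
      go-w : ∀ i b → Edge (w i) b → Hit (w i) b
      go-w i b e with i ≟ y
      ... | no i≢y = inj₁ (w∈ i i≢y)
      ... | yes refl with nbr-w i b e
      ... | inj₁ refl             = inj₂ 2∈
      ... | inj₂ (j , j≢i , refl) = inj₂ (w∈ j j≢i)
      go : ∀ a b → Edge a b → Hit a b
      go 2F b e = inj₁ 2∈
      go 3F b e = go-w 0F b e
      go 4F b e = go-w 1F b e
      go 5F b e = go-w 2F b e
      go (suc (suc (suc (suc (suc (suc l)))))) b e with refl ← nbr-leaf l b e = inj₂ 2∈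
      go 0F b e = case nbr-0 b e of λ where
        (inj₁ refl) → 01∈
        (inj₂ refl) → inj₂ 2∈
      go 1F b e = case nbr-1 b e of λ where
        (inj₁ refl) → [ inj₂ , inj₁ ]′ 01∈
        (inj₂ refl) → inj₂ 2∈

    Index : Set
    Index = (Fin k × Fin 3) ⊎ (Fin 2 × Fin 3) ⊎ ⊤

    indices : List Index
    indices = map inj₁ (cartesianProduct (allFin k) (allFin 3)) ++
              map inj₂ (map inj₁ (cartesianProduct (allFin 2) (allFin 3)) ++ inj₂ tt ∷ [])

    length-indices : length indices ≡ 3 * k + 7
    length-indices = trans (length-++ (map inj₁ (cartesianProduct (allFin k) (allFin 3))))
      (cong (_+ 7) (trans (length-map _ (cartesianProduct (allFin k) (allFin 3)))
        (trans (length-cartesianProduct (allFin k) (allFin 3))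
        (trans (cong (_* 3) (length-tabulate {n = k} id)) (ℕ.*-comm k 3)))))

    ∈-indices : ∀ i → i ∈ₗ indices
    ∈-indices (inj₁ (l , y)) = ∈-++⁺ˡ (∈-map⁺ inj₁ (∈-cartesianProduct⁺ (∈-allFin l) (∈-allFin y)))
    ∈-indices (inj₂ (inj₁ (c , y))) =
      ∈-++⁺ʳ (map inj₁ (cartesianProduct (allFin k) (allFin 3)))
        (∈-map⁺ inj₂ (∈-++⁺ˡ (∈-map⁺ inj₁ (∈-cartesianProduct⁺ (∈-allFin c) (∈-allFin y)))))
    ∈-indices (inj₂ (inj₂ tt)) =
      ∈-++⁺ʳ (map inj₁ (cartesianProduct (allFin k) (allFin 3)))
        (∈-map⁺ inj₂ (∈-++⁺ʳ (map inj₁ (cartesianProduct (allFin 2) (allFin 3))) (here refl)))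

    side : Fin 2 × Fin 3 → List (V × V)
    side (c , y) = (2F , v c) ∷ opp w y ∷ []

    canonical : Index → List (V × V)
    canonical (inj₁ (l , y))   = (2F , leaf l) ∷ (0F , 1F) ∷ opp w y ∷ []
    canonical (inj₂ (inj₁ cy)) = side cy
    canonical (inj₂ (inj₂ tt)) = (2F , 3F) ∷ (0F , 1F) ∷ (4F , 5F) ∷ []

    opp-covers : ∀ {P} y → (∀ {u} → u ∈ₗ endpoints T₃₃ (opp w y ∷ []) → u ∈ₗ endpoints T₃₃ P) →
      ∀ i → i ≢ y → w i ∈ₗ endpoints T₃₃ P
    opp-covers y sub i i≢y with ≢⇒nxt⊎prv y i i≢y
    ... | inj₁ refl = sub (here refl)
    ... | inj₂ refl = sub (there (here refl))

    side-dominating : ∀ cy → Dominating T₃₃ (side cy)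
    side-dominating (0F , y) = dominating y (here refl) (inj₁ (there (here refl)))
      (opp-covers {side (0F , y)} y (λ u∈ → there (there u∈)))
    side-dominating (1F , y) = dominating y (here refl) (inj₂ (there (here refl)))
      (opp-covers {side (1F , y)} y (λ u∈ → there (there u∈)))

    canonical-dominating : ∀ i → Dominating T₃₃ (canonical i)
    canonical-dominating (inj₁ (l , y)) = dominating y (here refl) (inj₁ (there (there (here refl))))
      (opp-covers {canonical (inj₁ (l , y))} y (λ u∈ → there (there (there (there u∈)))))
    canonical-dominating (inj₂ (inj₁ cy)) = side-dominating cy
    canonical-dominating (inj₂ (inj₂ tt)) = dominating {canonical (inj₂ (inj₂ tt))} 0F
      (here refl) (inj₁ (there (there (here refl)))) λ where
        0F i≢ → contradiction refl i≢
        1F _  → there (there (there (there (here refl))))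
        2F _  → there (there (there (there (there (here refl)))))

    canonical-≤3 : ∀ i → length (canonical i) ≤ 3
    canonical-≤3 (inj₁ _)         = ℕ.≤-refl
    canonical-≤3 (inj₂ (inj₁ _)) = s≤s (s≤s z≤n)
    canonical-≤3 (inj₂ (inj₂ _)) = ℕ.≤-refl

    side-disjoint : ∀ cy → Disjoint T₃₃ (side cy)
    side-disjoint (c , y) = add (edge⇒adj {2F} {v c} (2-v c))
      (2≢w _ ∷ 2≢w _ ∷ []) (v≢w c _ ∷ v≢w c _ ∷ [])
      (add (w-triangle (nxt≢prv y)) [] [] [])

    module _ (l₀ : Fin k) {M : EdgeSet T₃₃} (max : IsMaximalMatching T₃₃ M) where

      -- The edge v₁v₂ must be met by `M`, and the only other neighbour of v₁ and v₂ is the hub,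
      -- whose mate lies elsewhere.
      edge₀₁ : ∀ {x} → Matched T₃₃ M 2F x → 0F ≢ x → 1F ≢ x → Matched T₃₃ M 0F 1F
      edge₀₁ m 0≢x 1≢x with maximal⇒covers T₃₃ max {0F} {1F} (edge⇒adj {0F} {1F} tt)
      ... | inj₁ (y , m′) = case nbr-0 y (matched⇒edge {M} m′) of λ where
        (inj₁ refl) → m′
        (inj₂ refl) → contradiction (mate-unique T₃₃ {M} (proj₁ max) (matched-sym T₃₃ {M} m′) m) 0≢x
      ... | inj₂ (y , m′) = case nbr-1 y (matched⇒edge {M} m′) of λ where
        (inj₁ refl) → matched-sym T₃₃ {M} m′
        (inj₂ refl) → contradiction (mate-unique T₃₃ {M} (proj₁ max) (matched-sym T₃₃ {M} m′) m) 1≢x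

      edge-w : ∃[ y ] Matched T₃₃ M (w (nxt y)) (w (prv y))
      edge-w with maximal⇒covers T₃₃ max {4F} {5F} (edge⇒adj {4F} {5F} tt)
      ... | inj₁ (x , m) = case nbr-4 x (matched⇒edge {M} m) of λ where
        (inj₁ refl) → 2F , matched-sym T₃₃ {M} m
        (inj₂ refl) → 0F , m
      ... | inj₂ (x , m) = case nbr-5 x (matched⇒edge {M} m) of λ where
        (inj₁ refl) → 1F , m
        (inj₂ refl) → 0F , matched-sym T₃₃ {M} m

      -- The edge from the hub to the leaf `l₀` must be met, and a covered leaf can only be matched
      -- to the hub.
      hub-covered : Covered T₃₃ M 2F
      hub-covered with maximal⇒covers T₃₃ max {2F} {leaf l₀} (edge⇒adj {2F} {leaf l₀} tt)
      ... | inj₁ c = c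
      ... | inj₂ (x , m) with refl ← nbr-leaf l₀ x (matched⇒edge {M} m) = _ , matched-sym T₃₃ {M} m

      -- The mate of the hub decides the type: v₁ or v₂, a leaf, or w₁. In the last two cases v₁v₂
      -- is forced, and for w₁ so is w₂w₃.
      classify : ∃[ i ] Contains T₃₃ M (canonical i)
      classify with hub-covered
      ... | x , m with nbr-2 x (matched⇒edge {M} m) | edge-w
      ... | inj₁ (c , refl)        | y , my = inj₂ (inj₁ (c , y)) , m ∷ my ∷ []
      ... | inj₂ (inj₂ (l , refl)) | y , my =
        inj₁ (l , y) , m ∷ edge₀₁ m (λ ()) (λ ()) ∷ my ∷ []
      ... | inj₂ (inj₁ refl) | y , my = inj₂ (inj₂ tt) , m ∷ edge₀₁ m (λ ()) (λ ()) ∷ edge₄₅ y my ∷ []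
        where
        3-free : ∀ {x} → 2F ≢ x → ¬ Matched T₃₃ M 3F x
        3-free 2≢x m′ = 2≢x (mate-unique T₃₃ {M} (proj₁ max) (matched-sym T₃₃ {M} m) m′)
        edge₄₅ : ∀ y → Matched T₃₃ M (w (nxt y)) (w (prv y)) → Matched T₃₃ M 4F 5F
        edge₄₅ 0F my = my
        edge₄₅ 1F my = contradiction (matched-sym T₃₃ {M} my) (3-free λ ())
        edge₄₅ 2F my = contradiction my (3-free λ ())

  T-size-≤3 : Fin k → All (λ M → ∣ M ∣ ≤ 3) (maximalMatchings T₃₃)
  T-size-≤3 l₀ = All.tabulate λ M∈ →
    let max   = ∈-maximalMatchings⁻ T₃₃ M∈
        i , c = classify l₀ max
    in ℕ.≤-trans (dominating-≤ T₃₃ (canonical-dominating i) (proj₁ max) c) (canonical-≤3 i)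

  -- Each `canonical i` is dominating and thus contained in at most one maximal matching; 3k indices
  -- come from leaves, six from v₁ and v₂, and one from the edge v₃w₁.
  T-#maximal-≤ : Fin k → #maximal T₃₃ ≤ 3 * k + 7
  T-#maximal-≤ l₀ = subst (#maximal T₃₃ ≤_) length-indices
    (pigeonhole (λ M i → IsMaximalMatching T₃₃ M × Contains T₃₃ M (canonical i))
      (λ {_} {_} {i} (max , c) (max′ , c′) → dominating-≡ T₃₃ (canonical-dominating i) max max′ c c′)
      (maximalMatchings-unique T₃₃) λ M∈ →
        let max   = ∈-maximalMatchings⁻ T₃₃ M∈
            i , c = classify l₀ max
        in i , ∈-indices i , max , c)

  -- The hub is matched to v₁ or v₂ and any of the three sides of the other triangle is added.
  T-#2-≥ : 6 ≤ length (withSize2 T₃₃)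
  T-#2-≥ = pigeonhole (λ cy M → IsMatching T₃₃ M × Contains T₃₃ M (side cy)) separate
    (Unique.cartesianProduct⁺ (Unique.allFin⁺ 2) (Unique.allFin⁺ 3)) λ {cy} _ →
      let M , max , c = disjoint⇒maximal T₃₃ (side-disjoint cy)
      in M ,
         ∈-filter⁺ (λ M → ∣ M ∣ ℕ.≟ 2) (∈-maximalMatchings⁺ T₃₃ max)
           (ℕ.≤-antisym (dominating-≤ T₃₃ (side-dominating cy) (proj₁ max) c)
                        (contains-≤ T₃₃ (side-disjoint cy) c)) ,
         proj₁ max , c
    where
    separate : ∀ {cy cy′ M} → IsMatching T₃₃ M × Contains T₃₃ M (side cy) →
      IsMatching T₃₃ M × Contains T₃₃ M (side cy′) → cy ≡ cy′
    separate {M = M} (mat , (m ∷ o ∷ [])) (_ , (m′ ∷ o′ ∷ [])) =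
      cong₂ _,_ (v-injective (mate-unique T₃₃ {M} mat m m′))
                (opp-separates T₃₃ {M} w-triangle mat o o′)

  T-avm-upper : Fin k → (3 * k + 7) * totalSize T₃₃ ≤ (9 * k + 15) * #maximal T₃₃
  T-avm-upper l₀ = avm-upper T₃₃ k (T-size-≤3 l₀) (T-#maximal-≤ l₀) T-#2-≥

-- Edge counting and the structure forced by a maximal matching of size 2.

-- Distinct pairs i < j name distinct edges.
Increasing : ∀ {m} → List (Fin m × Fin m) → Set
Increasing es = Unique es × All (λ (i , j) → toℕ i < toℕ j) es

increasing? : ∀ {m} (es : List (Fin m × Fin m)) → Dec (Increasing es)
increasing? es = DecUnique.unique? (≡-dec _≟_ _≟_) es ×-dec All.all? (λ (i , j) → toℕ i <? toℕ j) es

-- Edges of two near-triangles with crossing edges su and tv, as positions in the vertex list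
-- s, t, x(, x′), u, v, y(, y′); x and x′ are adjacent to s and t, and y and y′ to u and v.
edges₃₃ : List (Fin 6 × Fin 6)
edges₃₃ = (0F , 1F) ∷ (0F , 2F) ∷ (1F , 2F) ∷ (3F , 4F) ∷ (3F , 5F) ∷ (4F , 5F) ∷
          (0F , 3F) ∷ (1F , 4F) ∷ []

edges₄₃ : List (Fin 7 × Fin 7)
edges₄₃ = (0F , 2F) ∷ (1F , 2F) ∷ (0F , 3F) ∷ (1F , 3F) ∷ (4F , 5F) ∷ (4F , 6F) ∷ (5F , 6F) ∷
          (0F , 4F) ∷ (1F , 5F) ∷ []

edges₃₄ : List (Fin 7 × Fin 7)
edges₃₄ = (0F , 1F) ∷ (0F , 2F) ∷ (1F , 2F) ∷ (3F , 5F) ∷ (4F , 5F) ∷ (3F , 6F) ∷ (4F , 6F) ∷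
          (0F , 3F) ∷ (1F , 4F) ∷ []

edges₄₄ : List (Fin 8 × Fin 8)
edges₄₄ = (0F , 2F) ∷ (1F , 2F) ∷ (0F , 3F) ∷ (1F , 3F) ∷ (4F , 6F) ∷ (5F , 6F) ∷ (4F , 7F) ∷
          (5F , 7F) ∷ (0F , 4F) ∷ (1F , 5F) ∷ []

increasing₃₃ : Increasing edges₃₃
increasing₃₃ = from-yes (increasing? edges₃₃)

increasing₄₃ : Increasing edges₄₃
increasing₄₃ = from-yes (increasing? edges₄₃)

increasing₃₄ : Increasing edges₃₄
increasing₃₄ = from-yes (increasing? edges₃₄)

increasing₄₄ : Increasing edges₄₄
increasing₄₄ = from-yes (increasing? edges₄₄)

six : ∀ {n} → (a b : Fin 3 → Fin n) → List (Fin n)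
six a b = tabulate a ++ tabulate b

a∈six : ∀ {n} (a b : Fin 3 → Fin n) i → a i ∈ₗ six a b
a∈six a b i = ∈-++⁺ˡ (∈-tabulate⁺ {f = a} i)

b∈six : ∀ {n} (a b : Fin 3 → Fin n) i → b i ∈ₗ six a b
b∈six a b i = ∈-++⁺ʳ (tabulate a) (∈-tabulate⁺ {f = b} i)

∈-six⁻ : ∀ {n} (a b : Fin 3 → Fin n) {v} → v ∈ₗ six a b → ∃[ i ] v ≡ a i ⊎ ∃[ i ] v ≡ b i
∈-six⁻ a b v∈ = case ∈-++⁻ (tabulate a) v∈ of λ where
  (inj₁ p) → inj₁ (∈-tabulate⁻ {f = a} p)
  (inj₂ p) → inj₂ (∈-tabulate⁻ {f = b} p)

six-unique : ∀ {n} {a b : Fin 3 → Fin n} → (∀ {i j} → a i ≡ a j → i ≡ j) →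
  (∀ {i j} → b i ≡ b j → i ≡ j) → (∀ i j → a i ≢ b j) → Unique (six a b)
six-unique {a = a} {b} a-inj b-inj a≢b = Unique.++⁺ (Unique.tabulate⁺ a-inj) (Unique.tabulate⁺ b-inj) λ (p , q) →
  case ∈-tabulate⁻ {f = a} p , ∈-tabulate⁻ {f = b} q of λ where
    ((i , refl) , (j , eq)) → a≢b i j eq

step-out : ∀ {A : Set} {R : A → A → Set} {Q : A → Set} → (∀ x → Dec (Q x)) → ∀ {x y} → Star R x y →
  Q x → ¬ Q y → ∃[ u ] ∃[ v ] (Q u × ¬ Q v × R u v)
step-out Q? ε        qx ¬qy = contradiction qx ¬qy
step-out Q? (_◅_ {j = z} r rs) qx ¬qy with Q? z
... | yes qz = step-out Q? rs qz ¬qy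
... | no ¬qz = _ , _ , qx , ¬qz , r

module _ {n : ℕ} (G : Graph n) where

  private
    V : Set
    V = Fin n

  -- The common property of a cycle of any length and of a triangle, so that `two-covered` serves
  -- both.
  MinDegree2 : (V → Set) → Set
  MinDegree2 W = ∀ {w} → W w → ∃[ j ] ∃[ k ] (j ≢ k × W j × W k × Adj G w j × Adj G w k)

  On : ∀ {m} → (Fin m → V) → V → Set
  On f v = ∃[ i ] v ≡ f i

  triangle-minDegree2 : ∀ {t} → Triangle G t → MinDegree2 (On t)
  triangle-minDegree2 {t} tri (i , refl) = t (nxt i) , t (prv i) ,
    triangle-≢ G tri (nxt≢prv i) , (nxt i , refl) , (prv i , refl) ,
    tri (≢-sym (nxt≢ i)) , tri (≢-sym (prv≢ i))

  cycle-minDegree2 : ∀ {p} (C : Cycle G p) → MinDegree2 (On (Cycle.vertex C))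
  cycle-minDegree2 {0} C = contradiction (Cycle.3≤p C) λ ()
  cycle-minDegree2 {1} C = contradiction (Cycle.3≤p C) λ { (s≤s ()) }
  cycle-minDegree2 {2} C = contradiction (Cycle.3≤p C) λ { (s≤s (s≤s ())) }
  cycle-minDegree2 {p@(suc (suc (suc p′)))} C (i , refl) with next i | prev i
    where
    open Cycle C
    next : ∀ i → ∃[ j ] (Adj G (vertex i) (vertex j) ×
                         (toℕ j ≡ suc (toℕ i) ⊎ (suc (toℕ i) ≡ p × toℕ j ≡ 0)))
    next i with suc (toℕ i) <? p
    ... | yes lt = fromℕ< lt , step i _ (toℕ-fromℕ< lt) , inj₁ (toℕ-fromℕ< lt)
    ... | no ≮p = zero , close i zero last refl , inj₂ (last , refl)
      where last = ℕ.≤-antisym (toℕ<n i) (ℕ.≮⇒≥ ≮p)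
    prev : ∀ i → ∃[ k ] (Adj G (vertex i) (vertex k) ×
                         (toℕ i ≡ suc (toℕ k) ⊎ (toℕ i ≡ 0 × suc (toℕ k) ≡ p)))
    prev zero = fromℕ< (ℕ.n<1+n (suc (suc p′))) , adj-sym G (close _ zero eq refl) , inj₂ (refl , eq)
      where eq = cong suc (toℕ-fromℕ< (ℕ.n<1+n (suc (suc p′))))
    prev (suc i) = inject₁ i , adj-sym G (step _ (suc i) (cong suc (sym (toℕ-inject₁ i)))) ,
      inj₁ (cong suc (sym (toℕ-inject₁ i)))
  ... | j , ij , pj | k , ik , pk = vertex j , vertex k , (λ eq → differ (injective eq) pj pk) ,
      (j , refl) , (k , refl) , ij , ik
    where
    open Cycle C
    -- Successor and predecessor on the cycle could coincide only for length at most 2; the cases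
    -- include the wrap-around at either end.
    differ : j ≡ k → (toℕ j ≡ suc (toℕ i) ⊎ (suc (toℕ i) ≡ p × toℕ j ≡ 0)) →
      (toℕ i ≡ suc (toℕ k) ⊎ (toℕ i ≡ 0 × suc (toℕ k) ≡ p)) → ⊥
    differ refl (inj₁ p) (inj₁ q) = ℕ.m≢1+n+m (toℕ i) {1} (trans q (cong suc p))
    differ refl (inj₁ p) (inj₂ (q , r)) = case trans (sym r) (cong suc (trans p (cong suc q))) of λ ()
    differ refl (inj₂ (p , r)) (inj₁ q) = case trans (sym p) (cong suc (trans q (cong suc r))) of λ ()
    differ refl (inj₂ (p , _)) (inj₂ (q , _)) = case trans (sym p) (cong suc q) of λ ()

  -- Any edge inside `W` yields a covered vertex `s`. If a neighbour `j` of `s` in `W` is uncovered,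
  -- all neighbours of `j` are covered, and one of its two neighbours in `W` differs from `s`.
  two-covered : ∀ {M W w} → IsMaximalMatching G M → MinDegree2 W → W w →
    ∃[ s ] ∃[ t ] (s ≢ t × (W s × W t) × Covered G M s × Covered G M t)
  two-covered {M} {W} {w} max deg Ww with deg Ww
  ... | j , _ , _ , Wj , _ , wj , _ = case maximal⇒covers G max wj of λ where
      (inj₁ c) → from Ww c
      (inj₂ c) → from Wj c
    where
    from : ∀ {s} → W s → Covered G M s → ∃[ s ] ∃[ t ] (s ≢ t × (W s × W t) × Covered G M s × Covered G M t)
    from {s} Ws cs with deg Ws
    ... | j , _ , _ , Wj , _ , sj , _ with covered? G M j
    ... | yes cj = s , j , adj⇒≢ G sj , (Ws , Wj) , cs , cj
    ... | no ¬cj with deg Wj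
    ... | k , l , k≢l , Wk , Wl , jk , jl with k ≟ s
    ... | no  k≢s  = s , k , ≢-sym k≢s , (Ws , Wk) , cs ,
      [ (λ cj → contradiction cj ¬cj) , id ]′ (maximal⇒covers G max jk)
    ... | yes refl = s , l , k≢l , (Ws , Wl) , cs ,
      [ (λ cj → contradiction cj ¬cj) , id ]′ (maximal⇒covers G max jl)

  Apex : EdgeSet G → (V → Set) → V → V → V → Set
  Apex M W s t x = W x × ¬ Covered G M x × Adj G x s × Adj G x t

  -- Either a triangle on `s`, `t`, `x`, or a four-cycle through `s`, `x`, `t`, `x′`: in both cases
  -- as many known edges as vertices, which is what the edge count needs.
  Apices : EdgeSet G → (V → Set) → V → V → Set
  Apices M W s t =
    ∃[ x ] (Apex M W s t x × (Adj G s t ⊎ ∃[ x′ ] (x ≢ x′ × Apex M W s t x′)))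

  apices-swap : ∀ {M W s t} → Apices M W s t → Apices M W t s
  apices-swap (x , (Wx , ¬c , xs , xt) , inj₁ st) = x , (Wx , ¬c , xt , xs) , inj₁ (adj-sym G st)
  apices-swap (x , (Wx , ¬c , xs , xt) , inj₂ (x′ , ≢ , W′ , ¬c′ , xs′ , xt′)) =
    x , (Wx , ¬c , xt , xs) , inj₂ (x′ , ≢ , W′ , ¬c′ , xt′ , xs′)

  -- The neighbours of an uncovered vertex are covered, so its two neighbours in `W` are `s` and
  -- `t`. Of the two neighbours of `s` in `W`, either one is `t` and the other an apex, or both are
  -- apices.
  apices : ∀ {M W s t} → IsMaximalMatching G M → MinDegree2 W → W s →
    (∀ {w} → W w → Covered G M w → w ≡ s ⊎ w ≡ t) → Apices M W s t
  apices {M} {W} {s} {t} max deg Ws only = go (deg Ws)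
    where
    uncovered : ∀ {w} → W w → s ≢ w → w ≢ t → ¬ Covered G M w
    uncovered Ww s≢w w≢t c = [ s≢w ∘ sym , w≢t ]′ (only Ww c)
    apex : ∀ {w} → W w → ¬ Covered G M w → Apex M W s t w
    apex {w} Ww ¬c with deg Ww
    ... | l , m , l≢m , Wl , Wm , wl , wm with nbr Wl wl | nbr Wm wm
      where
      nbr : ∀ {v} → W v → Adj G w v → v ≡ s ⊎ v ≡ t
      nbr Wv wv = [ (λ c → contradiction c ¬c) , only Wv ]′ (maximal⇒covers G max wv)
    ... | inj₁ refl | inj₁ refl = contradiction refl l≢m
    ... | inj₁ refl | inj₂ refl = Ww , ¬c , wl , wm
    ... | inj₂ refl | inj₁ refl = Ww , ¬c , wm , wl
    ... | inj₂ refl | inj₂ refl = contradiction refl l≢m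
    go : ∃[ j ] ∃[ k ] (j ≢ k × W j × W k × Adj G s j × Adj G s k) → Apices M W s t
    go (j , k , j≢k , Wj , Wk , sj , sk) with j ≟ t | k ≟ t
    ... | yes refl | _ = k , apex Wk (uncovered Wk (adj⇒≢ G sk) (≢-sym j≢k)) , inj₁ sj
    ... | no j≢t | yes refl = j , apex Wj (uncovered Wj (adj⇒≢ G sj) j≢t) , inj₁ sk
    ... | no j≢t | no k≢t = j , apex Wj (uncovered Wj (adj⇒≢ G sj) j≢t) ,
      inj₂ (k , j≢k , apex Wk (uncovered Wk (adj⇒≢ G sk) k≢t))

  module _ {M : EdgeSet G} (mat : IsMatching G M) (size2 : ∣ M ∣ ≡ 2) {s t u v : V}
    (stuv! : Unique (s ∷ t ∷ u ∷ v ∷ [])) (cov : All (Covered G M) (s ∷ t ∷ u ∷ v ∷ [])) where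

    only-four : ∀ {w} → Covered G M w → w ∈ₗ s ∷ t ∷ u ∷ v ∷ []
    only-four {w} c = decidable-stable (w ∈ₗ? _) λ w∉ → contradiction
      (subst (λ m → 5 ≤ m + m) size2
        (covered-≤ G {M} (All.tabulate (λ { x∈ refl → w∉ x∈ }) ∷ stuv!) (c ∷ cov)))
      λ { (s≤s (s≤s (s≤s (s≤s ())))) }

    remaining-pair : ∀ {p q r r′} → p ≢ r → q ≢ r → Matched G M p q → Covered G M r →
      (∀ {w} → w ∈ₗ s ∷ t ∷ u ∷ v ∷ [] → w ∈ₗ p ∷ q ∷ r ∷ r′ ∷ []) → Matched G M r r′
    remaining-pair p≢r q≢r pq (y , ry) among with among (only-four (coveredʳ G {M} ry))
    ... | here refl = contradiction (mate-unique G {M} mat pq (matched-sym G {M} ry)) q≢r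
    ... | there (here refl) =
      contradiction (mate-unique G {M} mat (matched-sym G {M} pq) (matched-sym G {M} ry)) p≢r
    ... | there (there (here refl)) = contradiction refl (adj⇒≢ G (matched⇒adj G {M} ry))
    ... | there (there (there (here refl))) = ry

    mates : (Matched G M s t × Matched G M u v) ⊎
            (Matched G M s u × Matched G M t v) ⊎
            (Matched G M s v × Matched G M t u)
    mates = go stuv! cov
      where
      go : Unique (s ∷ t ∷ u ∷ v ∷ []) → All (Covered G M) (s ∷ t ∷ u ∷ v ∷ []) → _
      go ((s≢t ∷ s≢u ∷ s≢v ∷ []) ∷ (t≢u ∷ t≢v ∷ []) ∷ _) ((x , sx) ∷ ct ∷ cu ∷ _ ∷ [])
        with only-four (coveredʳ G {M} sx)
      ... | here refl = contradiction refl (adj⇒≢ G (matched⇒adj G {M} sx))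
      ... | there (here refl) = inj₁ (sx , remaining-pair s≢u t≢u sx cu id)
      ... | there (there (here refl)) = inj₂ (inj₁ (sx , remaining-pair s≢t (≢-sym t≢u) sx ct λ where
        (here p)                         → here p
        (there (here p))                 → there (there (here p))
        (there (there (here p)))         → there (here p)
        (there (there (there (here p)))) → there (there (there (here p)))))
      ... | there (there (there (here refl))) = inj₂ (inj₂ (sx , remaining-pair s≢t (≢-sym t≢v) sx ct λ where
        (here p)                         → here p
        (there (here p))                 → there (there (here p))
        (there (there (here p)))         → there (there (there (here p)))
        (there (there (there (here p)))) → there (here p)))

  -- Each vertex outside `vs` brings an edge into `vs`. These edges differ from one another by their
  -- outer end, and from `es` by having one.
  many-edges : ∀ {vs : List V} → Unique vs → (es : List (Fin (length vs) × Fin (length vs))) →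
    Increasing es →
    All (λ (i , j) → Adj G (lookup vs i) (lookup vs j)) es →
    (∀ {w} → w ∉ vs → ∃[ r ] (r ∈ₗ vs × Adj G w r)) → length es + n ≤ #edges G + length vs
  many-edges {vs} vs! es (es! , inc) adj nbr = begin
    length es + n                              ≤⟨ ℕ.+-monoʳ-≤ (length es) (≤-length-rest vs) ⟩
    length es + (length vs + length (rest vs)) ≡⟨ solve 3 (λ x y z → x :+ (y :+ z) := x :+ z :+ y) refl
                                                    (length es) (length vs) (length (rest vs)) ⟩
    length es + length (rest vs) + length vs   ≤⟨ ℕ.+-monoˡ-≤ (length vs) inner ⟩
    #edges G + length vs                       ∎
    where
    open ℕ.≤-Reasoning
    open +-*-Solver
    Pair : Set
    Pair = Fin (length vs) × Fin (length vs)
    Is : Pair ⊎ V → Fin (#edges G) → Set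
    Is (inj₁ (i , j)) e = toℕ i < toℕ j × Joins G e (lookup vs i) (lookup vs j)
    Is (inj₂ w)       e = w ∉ vs × ∃[ r ] (r ∈ₗ vs × Joins G e w r)
    mixed : ∀ {i j w e} → Is (inj₁ (i , j)) e → ¬ Is (inj₂ w) e
    mixed {i} {j} (_ , p) (w∉ , r , r∈ , q) with joins-ends G q p
    ... | inj₁ (refl , _) = w∉ (∈-lookup i)
    ... | inj₂ (refl , _) = w∉ (∈-lookup j)
    Is-injective : ∀ {x y e} → Is x e → Is y e → x ≡ y
    Is-injective {inj₁ (i , j)} {inj₁ (i′ , j′)} (i<j , p) (i′<j′ , q) with joins-ends G p q
    ... | inj₁ (eq , eq′) = cong inj₁ (cong₂ _,_ (lookup-injective vs! i i′ eq) (lookup-injective vs! j j′ eq′))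
    -- A pair and its reversal cannot both be increasing.
    ... | inj₂ (eq , eq′) with refl ← lookup-injective vs! i j′ eq | refl ← lookup-injective vs! j i′ eq′ =
      contradiction i<j (ℕ.<-asym i′<j′)
    Is-injective {inj₁ x} {inj₂ _} {e} p q = contradiction q (mixed {e = e} p)
    Is-injective {inj₂ _} {inj₁ _} {e} p q = contradiction p (mixed {e = e} q)
    Is-injective {inj₂ w} {inj₂ w′} (w∉ , _ , _ , p) (_ , _ , r′∈ , q) with joins-ends G p q
    ... | inj₁ (eq , _)   = cong inj₂ eq
    ... | inj₂ (refl , _) = contradiction r′∈ w∉
    realised : ∀ {x} → x ∈ₗ map inj₁ es ++ map inj₂ (rest vs) → ∃[ e ] (e ∈ₗ allFin (#edges G) × Is x e)
    realised x∈ with ∈-++⁻ (map inj₁ es) x∈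
    ... | inj₁ p with ∈-map⁻ inj₁ p
    ...   | _ , q , refl with adj⇒joins G (All.lookup adj q)
    ...     | e , j = e , ∈-allFin e , All.lookup inc q , j
    realised x∈ | inj₂ p with ∈-map⁻ inj₂ p
    ...   | w , q , refl with nbr (∈-rest⁻ q)
    ...     | r , r∈ , wr with adj⇒joins G wr
    ...       | e , j = e , ∈-allFin e , ∈-rest⁻ q , r , r∈ , j
    disjoint : ∀ {x} → ¬ (x ∈ₗ map inj₁ es × x ∈ₗ map inj₂ (rest vs))
    disjoint (p , q) with ∈-map⁻ inj₁ p
    ... | _ , _ , refl with ∈-map⁻ inj₂ q
    ... | _ , _ , ()
    inner : length es + length (rest vs) ≤ #edges G
    inner = subst₂ _≤_
      (trans (length-++ (map inj₁ es)) (cong₂ _+_ (length-map inj₁ es) (length-map inj₂ (rest vs))))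
      (length-tabulate {n = #edges G} id)
      (pigeonhole Is (λ {x} {y} {e} → Is-injective {x} {y} {e})
        (Unique.++⁺ (Unique.map⁺ inj₁-injective es!) (Unique.map⁺ inj₂-injective (rest-unique vs)) disjoint)
        realised)

  -- Extending `vs` to all of `G` adds at least one edge per vertex, so an excess of two edges over
  -- vertices would persist, while `G` has excess one.
  too-many-edges : #edges G ≡ n + 1 → (vs : List V) → Unique vs →
    (es : List (Fin (length vs) × Fin (length vs))) → length es ≡ 2 + length vs →
    Increasing es →
    All (λ (i , j) → Adj G (lookup vs i) (lookup vs j)) es →
    ¬ (∀ {w} → w ∉ vs → ∃[ r ] (r ∈ₗ vs × Adj G w r))
  too-many-edges size vs vs! es len inc adj nbr = ℕ.<-irrefl refl (begin-strict
    n + 1 + length vs  ≡⟨ solve 2 (λ n m → n :+ con 1 :+ m := con 1 :+ m :+ n) refl n (length vs) ⟩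
    1 + length vs + n  <⟨ ℕ.n<1+n _ ⟩
    2 + length vs + n  ≡⟨ cong (_+ n) len ⟨
    length es + n      ≤⟨ many-edges vs! es inc adj nbr ⟩
    #edges G + length vs ≡⟨ cong (_+ length vs) size ⟩
    n + 1 + length vs  ∎)
    where
    open ℕ.≤-Reasoning
    open +-*-Solver

  -- What a maximal matching of size 2 reveals about G: its four vertices cover all edges.
  record Dumbbell (a b : Fin 3 → V) : Set where
    field
      triangle-a    : Triangle G a
      triangle-b    : Triangle G b
      a≢b           : ∀ i j → a i ≢ b j
      cross-unique  : ∀ {i j i′ j′} → Adj G (a i) (b j) → Adj G (a i′) (b j′) → i ≡ i′ × j ≡ j′
      outside-nbr   : ∀ {w} → w ∉ six a b → ∃[ i ] Adj G w (a i) ⊎ ∃[ j ] Adj G w (b j)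
      outside-indep : ∀ {w w′} → w ∉ six a b → w′ ∉ six a b → ¬ Adj G w w′

    abs-unique : Unique (six a b)
    abs-unique = six-unique (triangle-injective G triangle-a) (triangle-injective G triangle-b) a≢b

  open Dumbbell

  ∉-six-swap : ∀ (a b : Fin 3 → V) {w} → w ∉ six a b → w ∉ six b a
  ∉-six-swap a b w∉ w∈ = case ∈-six⁻ b a w∈ of λ where
    (inj₁ (i , refl)) → w∉ (b∈six a b i)
    (inj₂ (i , refl)) → w∉ (a∈six a b i)

  dumbbell-swap : ∀ {a b} → Dumbbell a b → Dumbbell b a
  dumbbell-swap {a} {b} D = record
    { triangle-a    = triangle-b D
    ; triangle-b    = triangle-a D
    ; a≢b           = λ i j → ≢-sym (a≢b D j i)
    ; cross-unique  = λ p q → swap (cross-unique D (adj-sym G p) (adj-sym G q))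
    ; outside-nbr   = λ w∉ → Sum.swap (outside-nbr D (∉-six-swap b a w∉))
    ; outside-indep = λ p q → outside-indep D (∉-six-swap b a p) (∉-six-swap b a q)
    }

  -- Two different edges between the triangles, together with the six sides, would be eight edges on
  -- six vertices.
  cross-unique′ : #edges G ≡ n + 1 → ∀ {a b} → Triangle G a → Triangle G b → (∀ i j → a i ≢ b j) →
    (∀ {w} → w ∉ six a b → ∃[ r ] (r ∈ₗ six a b × Adj G w r)) →
    ∀ {i j i′ j′} → Adj G (a i) (b j) → Adj G (a i′) (b j′) → i ≡ i′ × j ≡ j′
  cross-unique′ size {a} {b} ta tb a≢b nbr {i} {j} {i′} {j′} ab ab′ with ≡-dec _≟_ _≟_ (i , j) (i′ , j′)
  ... | yes refl = refl , refl
  ... | no ij≢ = ⊥-elim (too-many-edges size (six a b)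
      (six-unique (triangle-injective G ta) (triangle-injective G tb) a≢b)
      (es i j i′ j′) refl ([ (λ eq → contradiction eq ij≢) , id ]′ (increasing i j i′ j′))
      (ta (λ ()) ∷ ta (λ ()) ∷ ta (λ ()) ∷ tb (λ ()) ∷ tb (λ ()) ∷ tb (λ ()) ∷
       subst₂ (Adj G) (sym (lookup-la i)) (sym (lookup-lb j)) ab ∷
       subst₂ (Adj G) (sym (lookup-la i′)) (sym (lookup-lb j′)) ab′ ∷ [])
      nbr)
    where
    la lb : Fin 3 → Fin 6
    la i = i ↑ˡ 3
    lb j = 3 ↑ʳ j
    lookup-la : ∀ i → lookup (six a b) (la i) ≡ a i
    lookup-la 0F = refl
    lookup-la 1F = refl
    lookup-la 2F = refl
    lookup-lb : ∀ j → lookup (six a b) (lb j) ≡ b j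
    lookup-lb 0F = refl
    lookup-lb 1F = refl
    lookup-lb 2F = refl
    es : (i j i′ j′ : Fin 3) → List (Fin 6 × Fin 6)
    es i j i′ j′ = (0F , 1F) ∷ (0F , 2F) ∷ (1F , 2F) ∷ (3F , 4F) ∷ (3F , 5F) ∷ (4F , 5F) ∷
                   (la i , lb j) ∷ (la i′ , lb j′) ∷ []
    increasing : ∀ i j i′ j′ → (i , j) ≡ (i′ , j′) ⊎ Increasing (es i j i′ j′)
    -- Evaluated for all 81 choices of end indices.
    increasing = from-yes (all? λ i → all? λ j → all? λ i′ → all? λ j′ →
      ≡-dec _≟_ _≟_ (i , j) (i′ , j′) ⊎-dec increasing? (es i j i′ j′))

-- Constructing the two triangles.

module _ {n : ℕ} (G : Graph n) where

  private
    V : Set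
    V = Fin n

    tri : V → V → V → Fin 3 → V
    tri x y z 0F = x
    tri x y z 1F = y
    tri x y z 2F = z

    tri-triangle : ∀ {x y z} → Adj G x y → Adj G z x → Adj G z y → Triangle G (tri x y z)
    tri-triangle xy zx zy {0F} {0F} ≢ = contradiction refl ≢
    tri-triangle xy zx zy {0F} {1F} _ = xy
    tri-triangle xy zx zy {0F} {2F} _ = adj-sym G zx
    tri-triangle xy zx zy {1F} {0F} _ = adj-sym G xy
    tri-triangle xy zx zy {1F} {1F} ≢ = contradiction refl ≢
    tri-triangle xy zx zy {1F} {2F} _ = adj-sym G zy
    tri-triangle xy zx zy {2F} {0F} _ = zx
    tri-triangle xy zx zy {2F} {1F} _ = zy
    tri-triangle xy zx zy {2F} {2F} ≢ = contradiction refl ≢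

    tri-all : ∀ {x y z} {Q : V → Set} → Q x → Q y → Q z → ∀ i → Q (tri x y z i)
    tri-all qx qy qz 0F = qx
    tri-all qx qy qz 1F = qy
    tri-all qx qy qz 2F = qz

  module _ (connected : Connected G) (size : #edges G ≡ n + 1) {W₁ W₂ : V → Set}
    (deg₁ : MinDegree2 G W₁) (deg₂ : MinDegree2 G W₂) (W₁#W₂ : ∀ {w} → W₁ w → ¬ W₂ w)
    {M : EdgeSet G} (max : IsMaximalMatching G M) (size2 : ∣ M ∣ ≡ 2) where

    private
      -- By connectivity `w` has some neighbour, the first step of a walk to `r`; as `w` is
      -- uncovered, maximality makes that neighbour covered.
      cover-nbr : ∀ {w} → ¬ Covered G M w → ∀ {r} → Covered G M r →
        ∃[ r ] (Covered G M r × Adj G w r)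
      cover-nbr {w} ¬c {r} c with connected w r
      ... | ε = contradiction c ¬c
      ... | _◅_ {j = j} wj _ = j , [ (λ c → contradiction c ¬c) , id ]′ (maximal⇒covers G max wj) , wj

      -- Each side, a triangle or a four-cycle, has as many edges as vertices, so `su` and `tv`
      -- would create an excess of two. The four cases of `go` are the combinations of the two
      -- shapes.
      not-crossing : ∀ {s t u v} → s ≢ t → u ≢ v → W₁ s × W₁ t → W₂ u × W₂ v →
        Covered G M s × Covered G M t → Covered G M u × Covered G M v →
        (∀ {vs} → s ∈ₗ vs → t ∈ₗ vs → u ∈ₗ vs → v ∈ₗ vs → ∀ {w} → w ∉ vs → ∃[ r ] (r ∈ₗ vs × Adj G w r)) →
        Apices G M W₁ s t → Apices G M W₂ u v → Adj G s u → ¬ Adj G t v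
      not-crossing {s} {t} {u} {v} s≢t u≢v (Ws , Wt) (Wu , Wv) (cs , ct) (cu , cv) nbr
        (x , (Wx , ¬x , xs , xt) , alt) (y , (Wy , ¬y , yu , yv) , alt′) su tv = go alt alt′
        where
        c≢ : ∀ {p q} → Covered G M p → ¬ Covered G M q → p ≢ q
        c≢ cp ¬cq refl = ¬cq cp
        apart : ∀ {ps qs} → All W₁ ps → All W₂ qs → ∀ {w} → ¬ (w ∈ₗ ps × w ∈ₗ qs)
        apart p q (w∈ , w∈′) = W₁#W₂ (All.lookup p w∈) (All.lookup q w∈′)
        three : ∀ {p q r} → p ≢ q → Covered G M p → Covered G M q → ¬ Covered G M r →
          Unique (p ∷ q ∷ r ∷ [])
        three p≢q cp cq ¬r = (p≢q ∷ c≢ cp ¬r ∷ []) ∷ (c≢ cq ¬r ∷ []) ∷ [] ∷ []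
        four : ∀ {p q r r′} → p ≢ q → Covered G M p → Covered G M q → ¬ Covered G M r → ¬ Covered G M r′ →
          r ≢ r′ → Unique (p ∷ q ∷ r ∷ r′ ∷ [])
        four p≢q cp cq ¬r ¬r′ r≢r′ =
          (p≢q ∷ c≢ cp ¬r ∷ c≢ cp ¬r′ ∷ []) ∷ (c≢ cq ¬r ∷ c≢ cq ¬r′ ∷ []) ∷ (r≢r′ ∷ []) ∷ [] ∷ []
        ⁻ : ∀ {p q} → Adj G p q → Adj G q p
        ⁻ = adj-sym G
        go : Adj G s t ⊎ ∃[ x′ ] (x ≢ x′ × Apex G M W₁ s t x′) →
             Adj G u v ⊎ ∃[ y′ ] (y ≢ y′ × Apex G M W₂ u v y′) → ⊥
        go (inj₁ st) (inj₁ uv) = too-many-edges G size (s ∷ t ∷ x ∷ u ∷ v ∷ y ∷ [])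
          (Unique.++⁺ (three s≢t cs ct ¬x) (three u≢v cu cv ¬y)
            (apart (Ws ∷ Wt ∷ Wx ∷ []) (Wu ∷ Wv ∷ Wy ∷ [])))
          edges₃₃ refl increasing₃₃
          (st ∷ ⁻ xs ∷ ⁻ xt ∷ uv ∷ ⁻ yu ∷ ⁻ yv ∷ su ∷ tv ∷ [])
          (nbr (here refl) (there (here refl)) (there (there (there (here refl))))
               (there (there (there (there (here refl))))))
        go (inj₂ (x′ , x≢x′ , Wx′ , ¬x′ , xs′ , xt′)) (inj₁ uv) = too-many-edges G size (s ∷ t ∷ x ∷ x′ ∷ u ∷ v ∷ y ∷ [])
          (Unique.++⁺ (four s≢t cs ct ¬x ¬x′ x≢x′) (three u≢v cu cv ¬y)
            (apart (Ws ∷ Wt ∷ Wx ∷ Wx′ ∷ []) (Wu ∷ Wv ∷ Wy ∷ [])))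
          edges₄₃ refl increasing₄₃
          (⁻ xs ∷ ⁻ xt ∷ ⁻ xs′ ∷ ⁻ xt′ ∷ uv ∷ ⁻ yu ∷ ⁻ yv ∷ su ∷ tv ∷ [])
          (nbr (here refl) (there (here refl)) (there (there (there (there (here refl)))))
               (there (there (there (there (there (here refl)))))))
        go (inj₁ st) (inj₂ (y′ , y≢y′ , Wy′ , ¬y′ , yu′ , yv′)) = too-many-edges G size (s ∷ t ∷ x ∷ u ∷ v ∷ y ∷ y′ ∷ [])
          (Unique.++⁺ (three s≢t cs ct ¬x) (four u≢v cu cv ¬y ¬y′ y≢y′)
            (apart (Ws ∷ Wt ∷ Wx ∷ []) (Wu ∷ Wv ∷ Wy ∷ Wy′ ∷ [])))
          edges₃₄ refl increasing₃₄
          (st ∷ ⁻ xs ∷ ⁻ xt ∷ ⁻ yu ∷ ⁻ yv ∷ ⁻ yu′ ∷ ⁻ yv′ ∷ su ∷ tv ∷ [])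
          (nbr (here refl) (there (here refl)) (there (there (there (here refl))))
               (there (there (there (there (here refl))))))
        go (inj₂ (x′ , x≢x′ , Wx′ , ¬x′ , xs′ , xt′)) (inj₂ (y′ , y≢y′ , Wy′ , ¬y′ , yu′ , yv′)) =
          too-many-edges G size (s ∷ t ∷ x ∷ x′ ∷ u ∷ v ∷ y ∷ y′ ∷ [])
          (Unique.++⁺ (four s≢t cs ct ¬x ¬x′ x≢x′) (four u≢v cu cv ¬y ¬y′ y≢y′)
            (apart (Ws ∷ Wt ∷ Wx ∷ Wx′ ∷ []) (Wu ∷ Wv ∷ Wy ∷ Wy′ ∷ [])))
          edges₄₄ refl increasing₄₄
          (⁻ xs ∷ ⁻ xt ∷ ⁻ xs′ ∷ ⁻ xt′ ∷ ⁻ yu ∷ ⁻ yv ∷ ⁻ yu′ ∷ ⁻ yv′ ∷ su ∷ tv ∷ [])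
          (nbr (here refl) (there (here refl)) (there (there (there (there (here refl)))))
               (there (there (there (there (there (here refl)))))))

    module _ {s t u v : V} (s≢t : s ≢ t) (Ws : W₁ s) (Wt : W₁ t) (cs : Covered G M s) (ct : Covered G M t)
      (u≢v : u ≢ v) (Wu : W₂ u) (Wv : W₂ v) (cu : Covered G M u) (cv : Covered G M v) where

      private
        ≢₁₂ : ∀ {p q} → W₁ p → W₂ q → p ≢ q
        ≢₁₂ W₁p W₂q refl = W₁#W₂ W₁p W₂q
        stuv! : Unique (s ∷ t ∷ u ∷ v ∷ [])
        stuv! = (s≢t ∷ ≢₁₂ Ws Wu ∷ ≢₁₂ Ws Wv ∷ []) ∷ (≢₁₂ Wt Wu ∷ ≢₁₂ Wt Wv ∷ []) ∷ (u≢v ∷ []) ∷ [] ∷ []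
        cov : All (Covered G M) (s ∷ t ∷ u ∷ v ∷ [])
        cov = cs ∷ ct ∷ cu ∷ cv ∷ []
        four : ∀ {w} → Covered G M w → w ∈ₗ s ∷ t ∷ u ∷ v ∷ []
        four = only-four G {M} (proj₁ max) size2 stuv! cov
        covered-∈ : ∀ {vs} → All (_∈ₗ vs) (s ∷ t ∷ u ∷ v ∷ []) → ∀ w → Covered G M w → w ∈ₗ vs
        covered-∈ {vs} ∈vs w c = All.lookup {P = _∈ₗ vs} ∈vs {w} (four {w} c)
        nbr-∈ : ∀ {vs} → All (_∈ₗ vs) (s ∷ t ∷ u ∷ v ∷ []) → ∀ {w} → ∃[ r ] (Covered G M r × Adj G w r) →
          ∃[ r ] (r ∈ₗ vs × Adj G w r)
        nbr-∈ ∈vs (r , c , wr) = r , covered-∈ ∈vs r c , wr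
        nbr : ∀ {vs} → s ∈ₗ vs → t ∈ₗ vs → u ∈ₗ vs → v ∈ₗ vs → ∀ {w} → w ∉ vs → ∃[ r ] (r ∈ₗ vs × Adj G w r)
        nbr {vs} s∈ t∈ u∈ v∈ {w} w∉ = nbr-∈ ∈vs (cover-nbr {w} (λ c → w∉ (covered-∈ ∈vs w c)) {s} cs)
          where
          ∈vs : All (_∈ₗ vs) (s ∷ t ∷ u ∷ v ∷ [])
          ∈vs = s∈ ∷ t∈ ∷ u∈ ∷ v∈ ∷ []
        only₁ : ∀ {w} → W₁ w → w ∈ₗ s ∷ t ∷ u ∷ v ∷ [] → w ≡ s ⊎ w ≡ t
        only₁ _  (here p)                            = inj₁ p
        only₁ _  (there (here p))                    = inj₂ p
        only₁ Ww (there (there (here refl)))         = contradiction Wu (W₁#W₂ Ww)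
        only₁ Ww (there (there (there (here refl)))) = contradiction Wv (W₁#W₂ Ww)
        only₂ : ∀ {w} → W₂ w → w ∈ₗ s ∷ t ∷ u ∷ v ∷ [] → w ≡ u ⊎ w ≡ v
        only₂ Ww (here refl)                      = contradiction Ww (W₁#W₂ Ws)
        only₂ Ww (there (here refl))              = contradiction Ww (W₁#W₂ Wt)
        only₂ _  (there (there (here p)))         = inj₁ p
        only₂ _  (there (there (there (here p)))) = inj₂ p
        apices₁ : Apices G M W₁ s t
        apices₁ = apices G {M} {W₁} {s} {t} max deg₁ Ws λ {w} Ww c → only₁ Ww (four {w} c)
        apices₂ : Apices G M W₂ u v
        apices₂ = apices G {M} {W₂} {u} {v} max deg₂ Wu λ {w} Ww c → only₂ Ww (four {w} c)
        glue : Matched G M s t → Matched G M u v → ∀ x y → Apex G M W₁ s t x → Apex G M W₂ u v y →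
          ∃[ a ] ∃[ b ] Dumbbell G a b
        glue st uv x y (Wx , _ , xs , xt) (Wy , _ , yu , yv) = a , b , record
          { triangle-a    = ta
          ; triangle-b    = tb
          ; a≢b           = a≢b
          ; cross-unique  = cross-unique′ G size {a} {b} ta tb a≢b nbr₆
          ; outside-nbr   = λ w∉ → on-a-or-b (nbr₆ w∉)
          ; outside-indep = λ {w} {w′} w∉ w′∉ ww′ →
              [ (λ c → w∉ (covered-∈ four⊆six w c)) , (λ c → w′∉ (covered-∈ four⊆six w′ c)) ]′
                (maximal⇒covers G max ww′)
          }
          where
          a b : Fin 3 → V
          a = tri s t x
          b = tri u v y
          ta : Triangle G a
          ta = tri-triangle (matched⇒adj G {M} st) xs xt
          tb : Triangle G b
          tb = tri-triangle (matched⇒adj G {M} uv) yu yv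
          a≢b : ∀ i j → a i ≢ b j
          a≢b i j = ≢₁₂ (tri-all {Q = W₁} Ws Wt Wx i) (tri-all {Q = W₂} Wu Wv Wy j)
          four⊆six : All (_∈ₗ six a b) (s ∷ t ∷ u ∷ v ∷ [])
          four⊆six = a∈six a b 0F ∷ a∈six a b 1F ∷ b∈six a b 0F ∷ b∈six a b 1F ∷ []
          nbr₆ : ∀ {w} → w ∉ six a b → ∃[ r ] (r ∈ₗ six a b × Adj G w r)
          nbr₆ = nbr {six a b} (a∈six a b 0F) (a∈six a b 1F) (b∈six a b 0F) (b∈six a b 1F)
          on-a-or-b : ∀ {w} → ∃[ r ] (r ∈ₗ six a b × Adj G w r) → ∃[ i ] Adj G w (a i) ⊎ ∃[ j ] Adj G w (b j)
          on-a-or-b (r , r∈ , wr) with ∈-six⁻ a b r∈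
          ... | inj₁ (i , refl) = inj₁ (i , wr)
          ... | inj₂ (j , refl) = inj₂ (j , wr)

        -- Both crossing pairings are excluded, so `s` is matched to `t` and `u` to `v`. Each of
        -- these edges then closes to a triangle with an apex, even if the given cycle was longer.
        construct : (Matched G M s t × Matched G M u v) ⊎ (Matched G M s u × Matched G M t v) ⊎
                    (Matched G M s v × Matched G M t u) → ∃[ a ] ∃[ b ] Dumbbell G a b
        construct (inj₁ (st , uv)) =
          let x , x-apex , _ = apices₁
              y , y-apex , _ = apices₂
          in glue st uv x y x-apex y-apex
        construct (inj₂ (inj₁ (su , tv))) = contradiction (matched⇒adj G {M} tv)
          (not-crossing s≢t u≢v (Ws , Wt) (Wu , Wv) (cs , ct) (cu , cv) nbr apices₁ apices₂
            (matched⇒adj G {M} su))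
        construct (inj₂ (inj₂ (sv , tu))) = contradiction (matched⇒adj G {M} tu)
          (not-crossing s≢t (≢-sym u≢v) (Ws , Wt) (Wv , Wu) (cs , ct) (cv , cu)
            (λ s∈ t∈ v∈ u∈ → nbr s∈ t∈ u∈ v∈) apices₁ (apices-swap G {M} {W₂} apices₂)
            (matched⇒adj G {M} sv))

      dumbbell-on : ∃[ a ] ∃[ b ] Dumbbell G a b
      dumbbell-on = construct (mates G {M} (proj₁ max) size2 stuv! cov)

    dumbbell : ∀ {w₁ w₂} → W₁ w₁ → W₂ w₂ → ∃[ a ] ∃[ b ] Dumbbell G a b
    dumbbell W₁w W₂w =
      let s , t , s≢t , (Ws , Wt) , cs , ct = two-covered G {M} {W₁} max deg₁ W₁w
          u , v , u≢v , (Wu , Wv) , cu , cv = two-covered G {M} {W₂} max deg₂ W₂w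
      in dumbbell-on s≢t Ws Wt cs ct u≢v Wu Wv cu cv

  size-≥2 : ∀ {W₁ W₂ : V → Set} → MinDegree2 G W₁ → MinDegree2 G W₂ → (∀ {w} → W₁ w → ¬ W₂ w) →
    ∀ {w₁ w₂} → W₁ w₁ → W₂ w₂ → ∀ {M} → IsMaximalMatching G M → 2 ≤ ∣ M ∣
  size-≥2 {W₁} {W₂} deg₁ deg₂ W₁#W₂ W₁w W₂w {M} max
    with two-covered G {M} {W₁} max deg₁ W₁w | two-covered G {M} {W₂} max deg₂ W₂w
  ... | s , t , s≢t , (Ws , Wt) , cs , ct | u , v , u≢v , (Wu , Wv) , cu , cv =
    halve (covered-≤ G {M} stuv! (cs ∷ ct ∷ cu ∷ cv ∷ []))
    where
    ≢₁₂ : ∀ {p q} → W₁ p → W₂ q → p ≢ q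
    ≢₁₂ W₁p W₂q refl = W₁#W₂ W₁p W₂q
    stuv! : Unique (s ∷ t ∷ u ∷ v ∷ [])
    stuv! = (s≢t ∷ ≢₁₂ Ws Wu ∷ ≢₁₂ Ws Wv ∷ []) ∷ (≢₁₂ Wt Wu ∷ ≢₁₂ Wt Wv ∷ []) ∷ (u≢v ∷ []) ∷ [] ∷ []
    halve : ∀ {m} → 4 ≤ m + m → 2 ≤ m
    halve {1} (s≤s (s≤s ()))
    halve {suc (suc _)} _ = s≤s (s≤s z≤n)

-- Arithmetic of the cases.

-- avm G > (9k + 15)/(3k + 7), cleared of denominators for a graph whose maximal matchings have size ≥ 2.
Wins : ∀ {n} → Graph n → ℕ → Set
Wins G k = (3 * k + 1) * length (withSize2 G) <
           6 * length (withSize≥ G 3) + (3 * k + 7) * length (withSize≥ G 4)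

module _ {n : ℕ} (G : Graph n) (k : ℕ) where

  private
    c₂ c₃ c₄ : ℕ
    c₂ = length (withSize2 G)
    c₃ = length (withSize≥ G 3)
    c₄ = length (withSize≥ G 4)

  open +-*-Solver
  open ℕ.≤-Reasoning

  wins-from : ∀ p q r → c₂ ≤ p → q ≤ c₃ → r ≤ c₄ → (3 * k + 1) * p < 6 * q + (3 * k + 7) * r → Wins G k
  wins-from p q r c₂≤ ≤c₃ ≤c₄ lt = begin-strict
    (3 * k + 1) * c₂           ≤⟨ ℕ.*-monoʳ-≤ (3 * k + 1) c₂≤ ⟩
    (3 * k + 1) * p            <⟨ lt ⟩
    6 * q + (3 * k + 7) * r    ≤⟨ ℕ.+-mono-≤ (ℕ.*-monoʳ-≤ 6 ≤c₃) (ℕ.*-monoʳ-≤ (3 * k + 7) ≤c₄) ⟩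
    6 * c₃ + (3 * k + 7) * c₄  ∎

  wins-none : c₂ ≤ 0 → 1 ≤ c₃ → Wins G k
  wins-none c₂≤ ≤c₃ = wins-from 0 1 0 c₂≤ ≤c₃ z≤n (begin-strict
    (3 * k + 1) * 0        ≡⟨ ℕ.*-zeroʳ (3 * k + 1) ⟩
    0                      <⟨ s≤s z≤n ⟩
    6 + (3 * k + 7) * 0    ∎)

  wins-three : 1 ≤ k → c₂ ≤ 3 → k * 3 ≤ c₃ → Wins G k
  wins-three (s≤s {n = m} z≤n) c₂≤ ≤c₃ = wins-from 3 (suc m * 3) 0 c₂≤ ≤c₃ z≤n (begin
    suc ((3 * suc m + 1) * 3)              ≤⟨ ℕ.m≤m+n _ (9 * m + 5) ⟩
    suc ((3 * suc m + 1) * 3) + (9 * m + 5)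
      ≡⟨ solve 1 (λ m → con 1 :+ (con 3 :* (con 1 :+ m) :+ con 1) :* con 3 :+ (con 9 :* m :+ con 5)
           := con 6 :* ((con 1 :+ m) :* con 3) :+ (con 3 :* (con 1 :+ m) :+ con 7) :* con 0) refl m ⟩
    6 * (suc m * 3) + (3 * suc m + 7) * 0  ∎)

  wins-five : c₂ ≤ 5 → k * 3 + 1 ≤ c₃ → Wins G k
  wins-five c₂≤ ≤c₃ = wins-from 5 (k * 3 + 1) 0 c₂≤ ≤c₃ z≤n (begin
    suc ((3 * k + 1) * 5)                  ≤⟨ ℕ.m≤m+n _ (3 * k) ⟩
    suc ((3 * k + 1) * 5) + 3 * k
      ≡⟨ solve 1 (λ k → con 1 :+ (con 3 :* k :+ con 1) :* con 5 :+ con 3 :* k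
           := con 6 :* (k :* con 3 :+ con 1) :+ (con 3 :* k :+ con 7) :* con 0) refl k ⟩
    6 * (k * 3 + 1) + (3 * k + 7) * 0      ∎)

  private
    -- Four matchings of size at least 4 alone outweigh four of size 2, as 4(3k + 7) > 4(3k + 1).
    -- Hence the bound on `k` matters only for smaller counts.
    4≤⇒ : ∀ q t → (3 * k + 1) * 4 < 6 * q + (3 * k + 7) * (4 + t)
    4≤⇒ q t = begin
      suc ((3 * k + 1) * 4)                ≤⟨ ℕ.m≤m+n _ (23 + 6 * q + (3 * k + 7) * t) ⟩
      suc ((3 * k + 1) * 4) + (23 + 6 * q + (3 * k + 7) * t)
        ≡⟨ solve 3 (λ k q t → con 1 :+ (con 3 :* k :+ con 1) :* con 4
               :+ (con 23 :+ con 6 :* q :+ (con 3 :* k :+ con 7) :* t)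
             := con 6 :* q :+ (con 3 :* k :+ con 7) :* (con 4 :+ t)) refl k q t ⟩
      6 * q + (3 * k + 7) * (4 + t)        ∎

  -- Here `t` is the number of outside vertices on the larger side and also a bound for the
  -- matchings of size 4. For t < 4 the condition k ≤ 2t leaves finitely many `k`, all evaluated.
  wins-four : ∀ t → 1 ≤ t → k ≤ t + t → c₂ ≤ 4 → t * 3 ≤ c₃ → t ≤ c₄ → Wins G k
  wins-four t 1≤t k≤ c₂≤ ≤c₃ ≤c₄ = wins-from 4 (t * 3) t c₂≤ ≤c₃ ≤c₄ (go t 1≤t k≤)
    where
    go : ∀ t → 1 ≤ t → k ≤ t + t → (3 * k + 1) * 4 < 6 * (t * 3) + (3 * k + 7) * t
    go 1 _ k≤ = from-yes (ℕ.allUpTo? (λ k → (3 * k + 1) * 4 <? 18 + (3 * k + 7) * 1) 3) (s≤s k≤)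
    go 2 _ k≤ = from-yes (ℕ.allUpTo? (λ k → (3 * k + 1) * 4 <? 36 + (3 * k + 7) * 2) 5) (s≤s k≤)
    go 3 _ k≤ = from-yes (ℕ.allUpTo? (λ k → (3 * k + 1) * 4 <? 54 + (3 * k + 7) * 3) 7) (s≤s k≤)
    go (suc (suc (suc (suc t)))) _ _ = 4≤⇒ ((4 + t) * 3) t

  -- The case of an outside vertex adjacent to both triangles: the larger side has t + 1 vertices,
  -- one of them lost for matchings of size 4. Counting the shared vertex once gives k ≤ 2(t + 1) -
  -- 1.
  wins-four′ : ∀ t → k ≤ 1 + (t + t) → c₂ ≤ 4 → suc t * 3 ≤ c₃ → t ≤ c₄ → Wins G k
  wins-four′ t k≤ c₂≤ ≤c₃ ≤c₄ = wins-from 4 (suc t * 3) t c₂≤ ≤c₃ ≤c₄ (go t k≤)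
    where
    go : ∀ t → k ≤ 1 + (t + t) → (3 * k + 1) * 4 < 6 * (suc t * 3) + (3 * k + 7) * t
    go 0 k≤ = from-yes (ℕ.allUpTo? (λ k → (3 * k + 1) * 4 <? 18 + (3 * k + 7) * 0) 2) (s≤s k≤)
    go 1 k≤ = from-yes (ℕ.allUpTo? (λ k → (3 * k + 1) * 4 <? 36 + (3 * k + 7) * 1) 4) (s≤s k≤)
    go 2 k≤ = from-yes (ℕ.allUpTo? (λ k → (3 * k + 1) * 4 <? 54 + (3 * k + 7) * 2) 6) (s≤s k≤)
    go 3 k≤ = from-yes (ℕ.allUpTo? (λ k → (3 * k + 1) * 4 <? 72 + (3 * k + 7) * 3) 8) (s≤s k≤)
    go (suc (suc (suc (suc t)))) _ = 4≤⇒ (suc (4 + t) * 3) t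

-- Counting maximal matchings of a dumbbell.

module _ {n : ℕ} (G : Graph n) {a b : Fin 3 → Fin n} (D : Dumbbell G a b) where

  open Dumbbell D

  private
    V : Set
    V = Fin n

  outs : List V
  outs = rest (six a b)

  n≡6+outs : n ≡ 6 + length outs
  n≡6+outs = ℕ.≤-antisym (≤-length-rest (six a b)) (length-rest-≤ abs-unique)

  outside≢a : ∀ {w} → w ∉ six a b → ∀ i → w ≢ a i
  outside≢a w∉ i refl = w∉ (a∈six a b i)

  outside≢b : ∀ {w} → w ∉ six a b → ∀ i → w ≢ b i
  outside≢b w∉ i refl = w∉ (b∈six a b i)

  opps : Fin 3 × Fin 3 → List (V × V)
  opps (x , y) = opp a x ∷ opp b y ∷ []

  -- The pair names the vertices `a x` and `b y` left over. That nothing further is covered makes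
  -- `opps xy` dominating, so the pair determines the matching.
  Shape : EdgeSet G → Fin 3 × Fin 3 → Set
  Shape M xy = IsMaximalMatching G M × Contains G M (opps xy) ×
    (∀ {w} → Covered G M w → w ∈ₗ endpoints G (opps xy))

  covered-pair : ∀ {M t} → Triangle G t → IsMaximalMatching G M →
    ∃[ x ] (Covered G M (t (nxt x)) × Covered G M (t (prv x)))
  covered-pair {M} {t} tri max = from (two-covered G {M} {On G t} max (triangle-minDegree2 G tri) (0F , refl))
    where
    from : ∃[ s ] ∃[ s′ ] (s ≢ s′ × (On G t s × On G t s′) × Covered G M s × Covered G M s′) →
      ∃[ x ] (Covered G M (t (nxt x)) × Covered G M (t (prv x)))
    from (_ , _ , s≢s′ , ((i , refl) , (j , refl)) , c , c′) with third i j (λ i≡j → s≢s′ (cong t i≡j))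
    ... | x , inj₁ (refl , refl) = x , c , c′
    ... | x , inj₂ (refl , refl) = x , c′ , c

  -- Each triangle contains two of the four covered vertices; a pairing across the triangles would
  -- use two different cross edges.
  shape : ∀ {M} → IsMaximalMatching G M → ∣ M ∣ ≡ 2 → ∃[ xy ] Shape M xy
  shape {M} max size2 = from (covered-pair {M} triangle-a max) (covered-pair {M} triangle-b max)
    where
    from : ∃[ x ] (Covered G M (a (nxt x)) × Covered G M (a (prv x))) →
           ∃[ y ] (Covered G M (b (nxt y)) × Covered G M (b (prv y))) → ∃[ xy ] Shape M xy
    from (x , c , c′) (y , d , d′) = (x , y) , max , contains (mates G {M} (proj₁ max) size2 four! cov) ,
        only-four G {M} (proj₁ max) size2 four! cov
      where
      four! : Unique (endpoints G (opps (x , y)))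
      four! = (triangle-≢ G triangle-a (nxt≢prv x) ∷ a≢b _ _ ∷ a≢b _ _ ∷ []) ∷ (a≢b _ _ ∷ a≢b _ _ ∷ []) ∷
              (triangle-≢ G triangle-b (nxt≢prv y) ∷ []) ∷ [] ∷ []
      cov : All (Covered G M) (endpoints G (opps (x , y)))
      cov = c ∷ c′ ∷ d ∷ d′ ∷ []
      two-cross : ∀ {j j′} → Matched G M (a (nxt x)) (b j) → ¬ Matched G M (a (prv x)) (b j′)
      two-cross m m′ = nxt≢prv x (proj₁ (cross-unique (matched⇒adj G {M} m) (matched⇒adj G {M} m′)))
      contains : _ → Contains G M (opps (x , y))
      contains (inj₁ (m , m′))        = m ∷ m′ ∷ []
      contains (inj₂ (inj₁ (m , m′))) = contradiction m′ (two-cross m)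
      contains (inj₂ (inj₂ (m , m′))) = contradiction m′ (two-cross m)

  module _ {M : EdgeSet G} {x y : Fin 3} (S : Shape M (x , y)) where

    private
      a-free : ¬ Covered G M (a x)
      a-free c = case proj₂ (proj₂ S) c of λ where
        (here p)                         → triangle-≢ G triangle-a (≢-sym (nxt≢ x)) p
        (there (here p))                 → triangle-≢ G triangle-a (≢-sym (prv≢ x)) p
        (there (there (here p)))         → a≢b _ _ p
        (there (there (there (here p)))) → a≢b _ _ p

      b-free : ¬ Covered G M (b y)
      b-free c = case proj₂ (proj₂ S) c of λ where
        (here p)                         → a≢b _ _ (sym p)
        (there (here p))                 → a≢b _ _ (sym p)
        (there (there (here p)))         → triangle-≢ G triangle-b (≢-sym (nxt≢ y)) p
        (there (there (there (here p)))) → triangle-≢ G triangle-b (≢-sym (prv≢ y)) p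

      outside-free : ∀ {w} → w ∉ six a b → ¬ Covered G M w
      outside-free w∉ c = case proj₂ (proj₂ S) c of λ where
        (here p)                         → outside≢a w∉ _ p
        (there (here p))                 → outside≢a w∉ _ p
        (there (there (here p)))         → outside≢b w∉ _ p
        (there (there (there (here p)))) → outside≢b w∉ _ p

    -- The vertices left over and those outside are all uncovered, so maximality forbids edges among
    -- them. This is what restricts the possible pairs.
    shape⇒a-light : ∀ {w} → w ∉ six a b → ¬ Adj G (a x) w
    shape⇒a-light w∉ e = [ a-free , outside-free w∉ ]′ (maximal⇒covers G (proj₁ S) e)

    shape⇒b-light : ∀ {w} → w ∉ six a b → ¬ Adj G (b y) w
    shape⇒b-light w∉ e = [ b-free , outside-free w∉ ]′ (maximal⇒covers G (proj₁ S) e)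

    shape⇒no-cross : ¬ Adj G (a x) (b y)
    shape⇒no-cross e = [ a-free , b-free ]′ (maximal⇒covers G (proj₁ S) e)

  shape-injective : ∀ {M N xy} → Shape M xy → Shape N xy → M ≡ N
  shape-injective {M} {N} {xy} (max , c , cov) (max′ , c′ , _) =
    dominating-≡ G {M} {N} {opps xy} dom max max′ c c′
    where
    dom : Dominating G (opps xy)
    dom e = Sum.map cov cov (maximal⇒covers G max e)

  #2-≤ : (xys : List (Fin 3 × Fin 3)) → (∀ {M x y} → Shape M (x , y) → (x , y) ∈ₗ xys) →
    length (withSize2 G) ≤ length xys
  #2-≤ xys ∈xys = pigeonhole Shape (λ {M} {N} {xy} → shape-injective {M} {N} {xy})
    (Unique.filter⁺ (λ M → ∣ M ∣ ℕ.≟ 2) (maximalMatchings-unique G)) λ {M} M∈ →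
      let M∈mm , size2 = ∈-filter⁻ (λ M → ∣ M ∣ ℕ.≟ 2) {xs = maximalMatchings G} M∈
          xy , S       = shape {M} (∈-maximalMatchings⁻ G M∈mm) size2
      in xy , ∈xys S , S

  opps-disjoint : ∀ x y → Disjoint G (opps (x , y))
  opps-disjoint x y = add (triangle-a (nxt≢prv x)) (a≢b _ _ ∷ a≢b _ _ ∷ []) (a≢b _ _ ∷ a≢b _ _ ∷ [])
    (add (triangle-b (nxt≢prv y)) [] [] [])

  private
    a-avoids : ∀ x y → All (a x ≢_) (endpoints G (opps (x , y)))
    a-avoids x y = triangle-≢ G triangle-a (≢-sym (nxt≢ x)) ∷ triangle-≢ G triangle-a (≢-sym (prv≢ x)) ∷
                   a≢b _ _ ∷ a≢b _ _ ∷ []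

    b-avoids : ∀ x y → All (b y ≢_) (endpoints G (opps (x , y)))
    b-avoids x y = ≢-sym (a≢b _ _) ∷ ≢-sym (a≢b _ _) ∷
                   triangle-≢ G triangle-b (≢-sym (nxt≢ y)) ∷ triangle-≢ G triangle-b (≢-sym (prv≢ y)) ∷ []

    outside-avoids : ∀ {w} → w ∉ six a b → ∀ x y → All (w ≢_) (endpoints G (opps (x , y)))
    outside-avoids w∉ x y = outside≢a w∉ _ ∷ outside≢a w∉ _ ∷ outside≢b w∉ _ ∷ outside≢b w∉ _ ∷ []

  leaf₃ : Fin 3 → V → Fin 3 → List (V × V)
  leaf₃ i l y = (a i , l) ∷ opps (i , y)

  leaf₃-disjoint : ∀ {i l} → l ∉ six a b → Adj G (a i) l → ∀ y → Disjoint G (leaf₃ i l y)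
  leaf₃-disjoint {i} l∉ e y = add e (a-avoids i y) (outside-avoids l∉ i y) (opps-disjoint i y)

  leaf₄ : Fin 3 → V → Fin 3 → V → List (V × V)
  leaf₄ i l j z = (a i , l) ∷ (b j , z) ∷ opps (i , j)

  leaf₄-disjoint : ∀ {i l j z} → l ∉ six a b → Adj G (a i) l → z ∉ six a b → Adj G (b j) z → l ≢ z →
    Disjoint G (leaf₄ i l j z)
  leaf₄-disjoint {i} {l} {j} l∉ al z∉ bz l≢z = add al
    (a≢b i j ∷ ≢-sym (outside≢a z∉ i) ∷ a-avoids i j)
    (outside≢b l∉ j ∷ l≢z ∷ outside-avoids l∉ i j)
    (add bz (b-avoids i j) (outside-avoids z∉ i j) (opps-disjoint i j))

  -- If `i` differed from `x`, then `a i` would be an end of the side opposite `a x` and have a mate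
  -- in the triangle as well as the mate `l` outside.
  hub-unique : ∀ {M i l x} → IsMatching G M → l ∉ six a b → Matched G M (a i) l →
    Matched G M (a (nxt x)) (a (prv x)) → i ≡ x
  hub-unique {M} {i} {l} {x} mat l∉ m o = decidable-stable (i ≟ x) λ i≢x →
    let j , _ , _ , m′ = opp-mate G {M} a o i i≢x
    in outside≢a l∉ j (mate-unique G {M} mat m m′)

  same-leaf : ∀ {M i l i′ l′} → IsMatching G M → l′ ∉ six a b → Matched G M (a i) l →
    Matched G M (a (nxt i)) (a (prv i)) → Matched G M (a i′) l′ → l ≡ l′
  same-leaf {M} mat l′∉ m o m′ with refl ← hub-unique {M} mat l′∉ m′ o = mate-unique G {M} mat m m′

  a-nbr? : ∀ l → Dec (∃[ i ] Adj G (a i) l)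
  a-nbr? l = any? λ i → T? (Graph.adj G (a i) l)

  b-nbr? : ∀ l → Dec (∃[ j ] Adj G (b j) l)
  b-nbr? l = any? λ j → T? (Graph.adj G (b j) l)

  hub : V → Fin 3
  hub l with a-nbr? l
  ... | yes (i , _) = i
  -- A default value; `hub` is applied to members of `a-outs`, where a neighbour exists.
  ... | no _        = 0F

  hub-adj : ∀ {l} → ∃[ i ] Adj G (a i) l → Adj G (a (hub l)) l
  hub-adj {l} al with a-nbr? l
  ... | yes (_ , e) = e
  ... | no ¬al      = contradiction al ¬al

  a-outs b-outs : List V
  a-outs = filter a-nbr? outs
  b-outs = filter b-nbr? outs

  ∈-a-outs⁻ : ∀ {l} → l ∈ₗ a-outs → l ∉ six a b × Adj G (a (hub l)) l
  ∈-a-outs⁻ l∈ = let l∈outs , al = ∈-filter⁻ a-nbr? {xs = outs} l∈ in ∈-rest⁻ l∈outs , hub-adj al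

  ∈-b-outs⁻ : ∀ {l} → l ∈ₗ b-outs → l ∉ six a b × ∃[ j ] Adj G (b j) l
  ∈-b-outs⁻ l∈ = let l∈outs , bl = ∈-filter⁻ b-nbr? {xs = outs} l∈ in ∈-rest⁻ l∈outs , bl

  a-outs-unique : Unique a-outs
  a-outs-unique = Unique.filter⁺ a-nbr? (rest-unique (six a b))

  private
    a₃ : List (V × Fin 3)
    a₃ = cartesianProduct a-outs (allFin 3)

    length-a₃ : length a₃ ≡ length a-outs * 3
    length-a₃ = length-cartesianProduct a-outs (allFin 3)

    a₃-unique : Unique a₃
    a₃-unique = Unique.cartesianProduct⁺ a-outs-unique (Unique.allFin⁺ 3)

    ∈-a₃⁻ : ∀ {l y} → (l , y) ∈ₗ a₃ → l ∉ six a b × Adj G (a (hub l)) l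
    ∈-a₃⁻ ly∈ = ∈-a-outs⁻ (proj₁ (∈-cartesianProduct⁻ a-outs (allFin 3) ly∈))

    leaf₃-separates : ∀ {M i l y i′ l′ y′} → IsMatching G M → l′ ∉ six a b →
      Contains G M (leaf₃ i l y) → Contains G M (leaf₃ i′ l′ y′) → (l , y) ≡ (l′ , y′)
    leaf₃-separates {M} mat l′∉ (m ∷ o ∷ p ∷ []) (m′ ∷ _ ∷ p′ ∷ []) =
      cong₂ _,_ (same-leaf {M} mat l′∉ m o m′) (opp-separates G {M} triangle-b mat p p′)

  #≥3-≥ : length a-outs * 3 ≤ length (withSize≥ G 3)
  #≥3-≥ = subst (_≤ length (withSize≥ G 3)) length-a₃
    (family-≤ G 3 (λ (l , y) → leaf₃ (hub l) l y) a₃-unique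
      (λ {(l , y)} ly∈ → let l∉ , e = ∈-a₃⁻ ly∈ in leaf₃-disjoint l∉ e y , ℕ.≤-refl)
      (λ {_} {_} {M} _ ly∈′ mat → leaf₃-separates {M} mat (proj₁ (∈-a₃⁻ ly∈′))))

  -- The cross edge with the two sides opposite its ends is one more matching. It contains the side
  -- opposite `a i₀`, so a common extension with some `leaf₃` would have hub `i₀`, which has no
  -- outside neighbour.
  #≥3-≥-cross : ∀ {i₀ j₀} → Adj G (a i₀) (b j₀) → (∀ {l} → l ∉ six a b → ¬ Adj G (a i₀) l) →
    length a-outs * 3 + 1 ≤ length (withSize≥ G 3)
  #≥3-≥-cross {i₀} {j₀} cross light = subst (_≤ length (withSize≥ G 3)) length-is
    (family-≤ G 3 P is! valid separate)
    where
    is : List (V × Fin 3 ⊎ ⊤)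
    is = map inj₁ a₃ ++ inj₂ tt ∷ []
    length-is : length is ≡ length a-outs * 3 + 1
    length-is = trans (length-++ (map inj₁ a₃)) (cong (_+ 1) (trans (length-map inj₁ a₃) length-a₃))
    is! : Unique is
    is! = Unique.++⁺ (Unique.map⁺ inj₁-injective a₃-unique) ([] ∷ []) λ where
      (p , here refl) → case ∈-map⁻ inj₁ p of λ ()
    P : V × Fin 3 ⊎ ⊤ → List (V × V)
    P (inj₁ (l , y)) = leaf₃ (hub l) l y
    P (inj₂ tt)      = (a i₀ , b j₀) ∷ opps (i₀ , j₀)
    is⁻ : ∀ {l y} → inj₁ (l , y) ∈ₗ is → l ∉ six a b × Adj G (a (hub l)) l
    is⁻ p with ∈-++⁻ (map inj₁ a₃) p
    ... | inj₂ (here ())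
    ... | inj₁ q with ∈-map⁻ inj₁ q
    ... | _ , ly∈ , refl = ∈-a₃⁻ ly∈
    valid : ∀ {i} → i ∈ₗ is → Disjoint G (P i) × 3 ≤ length (P i)
    valid {inj₁ (l , y)} i∈ = let l∉ , e = is⁻ i∈ in leaf₃-disjoint l∉ e y , ℕ.≤-refl
    valid {inj₂ tt}      _  = add cross (a-avoids i₀ j₀) (b-avoids i₀ j₀) (opps-disjoint i₀ j₀) , ℕ.≤-refl
    clash : ∀ {M l y} → inj₁ (l , y) ∈ₗ is → IsMatching G M →
      Contains G M (P (inj₁ (l , y))) → ¬ Contains G M (P (inj₂ tt))
    clash {M} l∈ mat (m ∷ _) (_ ∷ o ∷ _) = let l∉ , e = is⁻ l∈ in
      light l∉ (subst (λ i → Adj G (a i) _) (hub-unique {M} mat l∉ m o) e)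
    separate : ∀ {i j M} → i ∈ₗ is → j ∈ₗ is → IsMatching G M → Contains G M (P i) → Contains G M (P j) → i ≡ j
    separate {inj₁ _} {inj₁ _} {M} _ j∈ mat c c′ = cong inj₁ (leaf₃-separates {M} mat (proj₁ (is⁻ j∈)) c c′)
    separate {inj₁ _} {inj₂ tt} {M} i∈ _ mat c c′ = contradiction c′ (clash {M} i∈ mat c)
    separate {inj₂ tt} {inj₁ _} {M} _ j∈ mat c c′ = contradiction c (clash {M} j∈ mat c′)
    separate {inj₂ tt} {inj₂ tt} _ _ _ _ _ = refl

  -- One outside vertex `z` and one neighbour of it in B are fixed; the members of the family differ
  -- by the vertex hung on A, which must not be `z`.
  #≥4-≥ : ∀ {z} → z ∈ₗ b-outs → length (filter (λ l → ¬? (l ≟ z)) a-outs) ≤ length (withSize≥ G 4)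
  #≥4-≥ {z} z∈ = let z∉ , j , bz = ∈-b-outs⁻ z∈ in
    family-≤ G 4 (λ l → leaf₄ (hub l) l j z) (Unique.filter⁺ ≢z? a-outs-unique)
      (λ {l} l∈ → let l∈a , l≢z = ∈-filter⁻ ≢z? {xs = a-outs} l∈
                      l∉ , al   = ∈-a-outs⁻ l∈a
                  in leaf₄-disjoint l∉ al z∉ bz l≢z , ℕ.≤-refl)
      (λ {l} {l′} {M} _ l′∈ mat → separate {M} mat (proj₁ (∈-a-outs⁻ (proj₁ (∈-filter⁻ ≢z? {xs = a-outs} l′∈)))))
    where
    ≢z? : ∀ l → Dec (l ≢ z)
    ≢z? l = ¬? (l ≟ z)
    separate : ∀ {M l l′ j} → IsMatching G M → l′ ∉ six a b →
      Contains G M (leaf₄ (hub l) l j z) → Contains G M (leaf₄ (hub l′) l′ j z) → l ≡ l′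
    separate {M} mat l′∉ (m ∷ _ ∷ o ∷ _) (m′ ∷ _) = same-leaf {M} mat l′∉ m o m′

  outs-covered : ∀ {l} → l ∈ₗ outs → l ∈ₗ a-outs ⊎ l ∈ₗ b-outs
  outs-covered l∈ = Sum.map
    (λ (i , e) → ∈-filter⁺ a-nbr? l∈ (i , adj-sym G e))
    (λ (j , e) → ∈-filter⁺ b-nbr? l∈ (j , adj-sym G e)) (outside-nbr (∈-rest⁻ l∈))

  -- A triangle vertex with an outside neighbour is never left over, so two choices remain in each
  -- triangle.
  #2-≤4 : ∀ {i j w w′} → w ∉ six a b → Adj G (a i) w → w′ ∉ six a b → Adj G (b j) w′ →
    length (withSize2 G) ≤ 4
  #2-≤4 {i} {j} w∉ aw w′∉ bw′ =
    #2-≤ (cartesianProduct (nxt i ∷ prv i ∷ []) (nxt j ∷ prv j ∷ [])) λ {M} {x} {y} S →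
      ∈-cartesianProduct⁺ (others i x λ { refl → shape⇒a-light {M} S w∉ aw })
                          (others j y λ { refl → shape⇒b-light {M} S w′∉ bw′ })
    where
    others : ∀ i x → x ≢ i → x ∈ₗ nxt i ∷ prv i ∷ []
    others i x x≢i = [ here , (λ p → there (here p)) ]′ (≢⇒nxt⊎prv i x x≢i)

  -- The outside vertices are covered by the two lists, the first being the longer, so k is at most
  -- twice its length. If `z` lies in both lists, it drops out of the size-4 family but is also
  -- counted once less in the bound for k.
  wins-two-sided : ∀ {z} → z ∈ₗ b-outs → length b-outs ≤ length a-outs → Wins G (length outs)
  wins-two-sided {z} z∈ s≤r = split (z ∈ₗ? a-outs)
    where
    ≢z? : ∀ l → Dec (l ≢ z)
    ≢z? l = ¬? (l ≟ z)
    r t : ℕ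
    r = length a-outs
    t = length (filter ≢z? a-outs)
    1≤r : 1 ≤ r
    1≤r = ℕ.≤-trans (∈-length z∈) s≤r
    nonempty : ∀ {xs : List V} → 1 ≤ length xs → ∃[ x ] x ∈ₗ xs
    nonempty {x ∷ _} _ = x , here refl
    c₂≤4 : length (withSize2 G) ≤ 4
    c₂≤4 = let l , l∈       = nonempty {a-outs} 1≤r
               l∉ , al      = ∈-a-outs⁻ l∈
               z∉ , _ , bz  = ∈-b-outs⁻ z∈
           in #2-≤4 l∉ al z∉ bz
    split : Dec (z ∈ₗ a-outs) → Wins G (length outs)
    split (no z∉a) = wins-four G (length outs) r 1≤r
      (ℕ.≤-trans (subst (length outs ≤_) (length-++ a-outs)
          (unique-⊆⇒≤ {ys = a-outs ++ b-outs} (rest-unique (six a b))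
            (λ l∈ → [ ∈-++⁺ˡ , ∈-++⁺ʳ a-outs ]′ (outs-covered l∈))))
        (ℕ.+-monoʳ-≤ r s≤r))
      c₂≤4 #≥3-≥
      (ℕ.≤-trans
        (unique-⊆⇒≤ a-outs-unique (λ {l} l∈ → ∈-filter⁺ ≢z? l∈ λ { refl → z∉a l∈ }))
        (#≥4-≥ z∈))
    split (yes z∈a) = bound (delete z∈)
      where
      r≤ : r ≤ suc t
      r≤ = unique-⊆⇒≤ {ys = z ∷ filter ≢z? a-outs} a-outs-unique λ {l} l∈ → keep l∈ (l ≟ z)
        where
        keep : ∀ {l} → l ∈ₗ a-outs → Dec (l ≡ z) → l ∈ₗ z ∷ filter ≢z? a-outs
        keep l∈ (yes l≡z) = here l≡z
        keep l∈ (no  l≢z) = there (∈-filter⁺ ≢z? l∈ l≢z)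
      bound : ∃[ b′ ] (length b-outs ≡ suc (length b′) × (∀ {l} → l ∈ₗ b-outs → l ≢ z → l ∈ₗ b′)) →
        Wins G (length outs)
      bound (b′ , eq , keep) = finish r refl
        where
        cover : ∀ {l} → l ∈ₗ outs → l ∈ₗ a-outs ++ b′
        cover {l} l∈ with l ≟ z
        ... | yes refl = ∈-++⁺ˡ z∈a
        ... | no l≢z   = [ ∈-++⁺ˡ , (λ p → ∈-++⁺ʳ a-outs (keep p l≢z)) ]′ (outs-covered l∈)
        k≤ : length outs ≤ r + length b′
        k≤ = subst (length outs ≤_) (length-++ a-outs)
          (unique-⊆⇒≤ {ys = a-outs ++ b′} (rest-unique (six a b)) cover)
        finish : ∀ r′ → r′ ≡ r → Wins G (length outs)
        finish zero     r≡ = contradiction (subst (1 ≤_) (sym r≡) 1≤r) λ ()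
        finish (suc r′) r≡ = wins-four′ G (length outs) r′
          (ℕ.≤-trans k≤ (ℕ.≤-trans (ℕ.+-monoʳ-≤ r b′≤) (ℕ.≤-reflexive (cong (_+ r′) (sym r≡)))))
          c₂≤4 (subst (λ m → m * 3 ≤ _) (sym r≡) #≥3-≥)
          (ℕ.≤-trans (ℕ.≤-pred (subst (_≤ suc t) (sym r≡) r≤)) (#≥4-≥ z∈))
          where
          b′≤ : length b′ ≤ r′
          b′≤ = ℕ.≤-pred (subst₂ _≤_ eq (sym r≡) s≤r)

  module _ (no-b : ∀ {w} → w ∉ six a b → ∀ j → ¬ Adj G (b j) w) where

    outs≤a-outs : length outs ≤ length a-outs
    outs≤a-outs = unique-⊆⇒≤ (rest-unique (six a b)) λ l∈ →
      [ id , (λ p → let l∉ , j , bl = ∈-b-outs⁻ p in contradiction bl (no-b l∉ j)) ]′ (outs-covered l∈)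

    -- Neither `a i` nor `a i′` can be left over, so the third vertex of A is; three choices in B
    -- remain.
    wins-two-hubs : ∀ {i i′ w w′} → i ≢ i′ → w ∉ six a b → Adj G (a i) w → w′ ∉ six a b → Adj G (a i′) w′ →
      Wins G (length outs)
    wins-two-hubs {i} {i′} i≢i′ w∉ aw w′∉ aw′ = wins-three G (length outs) (∈-length (∈-rest⁺ w∉))
      (let x₃ , p = third i i′ i≢i′ in
       #2-≤ (cartesianProduct (x₃ ∷ []) (allFin 3)) λ {M} {x} {y} S →
         ∈-cartesianProduct⁺ {xs = x₃ ∷ []} {ys = allFin 3}
           (here (only x₃ p x (λ { refl → shape⇒a-light {M} S w∉ aw })
                              (λ { refl → shape⇒a-light {M} S w′∉ aw′ })))
           (∈-allFin y))
      (ℕ.≤-trans (ℕ.*-monoˡ-≤ 3 outs≤a-outs) #≥3-≥)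
      where
      only : ∀ x₃ → (i ≡ nxt x₃ × i′ ≡ prv x₃) ⊎ (i ≡ prv x₃ × i′ ≡ nxt x₃) → ∀ x → x ≢ i → x ≢ i′ → x ≡ x₃
      only x₃ p x x≢i x≢i′ = decidable-stable (x ≟ x₃) λ x≢x₃ → case ≢⇒nxt⊎prv x₃ x x≢x₃ , p of λ where
        (inj₁ q , inj₁ (refl , refl)) → x≢i q
        (inj₁ q , inj₂ (refl , refl)) → x≢i′ q
        (inj₂ q , inj₁ (refl , refl)) → x≢i′ q
        (inj₂ q , inj₂ (refl , refl)) → x≢i q

    -- The left-over vertex of A is one of two, which gives six pairs. Since `i₀` differs from `i`,
    -- the pair `(i₀ , j₀)` is among them, and its cross edge rules it out. The same edge supplies
    -- the additional larger matching.
    wins-one-hub : ∀ {i w i₀ j₀} → w ∉ six a b → Adj G (a i) w → i ≢ i₀ → Adj G (a i₀) (b j₀) →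
      (∀ {l} → l ∉ six a b → ¬ Adj G (a i₀) l) → Wins G (length outs)
    wins-one-hub {i} {w} {i₀} {j₀} w∉ aw i≢i₀ cross light = wins-five G (length outs)
      (subst (length (withSize2 G) ≤_)
        ([ (λ i≡i₀ → contradiction i≡i₀ i≢i₀) , id ]′ (five i i₀ j₀))
        (#2-≤ (allowed i i₀ j₀) λ {M} {x} {y} S → ∈-filter⁺ (≢-cross? i₀ j₀)
          (∈-cartesianProduct⁺ (others x λ { refl → shape⇒a-light {M} S w∉ aw }) (∈-allFin y))
          λ { refl → shape⇒no-cross {M} S cross }))
      (ℕ.≤-trans (ℕ.+-monoˡ-≤ 1 (ℕ.*-monoˡ-≤ 3 outs≤a-outs)) (#≥3-≥-cross cross light))
      where
      others : ∀ x → x ≢ i → x ∈ₗ nxt i ∷ prv i ∷ []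
      others x x≢i = [ here , (λ p → there (here p)) ]′ (≢⇒nxt⊎prv i x x≢i)
      ≢-cross? : ∀ i₀ j₀ (xy : Fin 3 × Fin 3) → Dec (xy ≢ (i₀ , j₀))
      ≢-cross? i₀ j₀ xy = ¬? (≡-dec _≟_ _≟_ xy (i₀ , j₀))
      allowed : (i i₀ j₀ : Fin 3) → List (Fin 3 × Fin 3)
      allowed i i₀ j₀ = filter (≢-cross? i₀ j₀) (cartesianProduct (nxt i ∷ prv i ∷ []) (allFin 3))
      five : ∀ i i₀ j₀ → i ≡ i₀ ⊎ length (allowed i i₀ j₀) ≡ 5
      five = from-yes (all? λ i → all? λ i₀ → all? λ j₀ → (i ≟ i₀) ⊎-dec (length (allowed i i₀ j₀) ℕ.≟ 5))

-- Recognising T_n^1(3,3).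

insert-self : ∀ {n} i j (π : Permutation′ n) → insert i j π ⟨$⟩ʳ i ≡ j
insert-self i j π with i ≟ i
... | yes _  = refl
... | no i≢i = contradiction refl i≢i

-- Induction on the domain: `f zero` is sent to 0, and the remaining values, renumbered with
-- `f zero` punched out, are handled by the permutation one size smaller.
extend-to-permutation : ∀ {m n} (f : Fin m → Fin n) → (∀ i j → f i ≡ f j → i ≡ j) →
  Σ[ π ∈ Permutation′ n ] (∀ i → toℕ (π ⟨$⟩ʳ f i) ≡ toℕ i)
extend-to-permutation {zero}         f inj = idₚ , λ ()
extend-to-permutation {suc m} {zero} f inj with () ← f zero
extend-to-permutation {suc m} {suc n} f inj =
  let π , p = extend-to-permutation g g-inj in
  insert (f zero) zero π , λ where
    zero    → cong toℕ (insert-self (f zero) zero π)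
    (suc i) → trans (cong (λ v → toℕ (insert (f zero) zero π ⟨$⟩ʳ v)) (sym (punchIn-punchOut (f0≢ i))))
              (trans (cong toℕ (insert-punchIn (f zero) zero π (g i))) (cong suc (p i)))
  where
  f0≢ : ∀ i → f zero ≢ f (suc i)
  f0≢ i eq = 0≢1+n (inj zero (suc i) eq)
  g : Fin m → Fin n
  g i = punchOut (f0≢ i)
  g-inj : ∀ i j → g i ≡ g j → i ≡ j
  g-inj i j eq with refl ← inj (suc i) (suc j) (punchOut-injective (f0≢ i) (f0≢ j) eq) = refl

module _ {n : ℕ} (G : Graph n) {a b : Fin 3 → Fin n} (D : Dumbbell G a b) {i₀ j₀ : Fin 3}
  (cross : Adj G (a i₀) (b j₀))
  (hub-all : ∀ {w} → w ∉ six a b → Adj G (a i₀) w)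
  (hub-only : ∀ {w} → w ∉ six a b → ∀ i → i ≢ i₀ → ¬ Adj G (a i) w)
  (no-b : ∀ {w} → w ∉ six a b → ∀ j → ¬ Adj G (b j) w) where

  open Dumbbell D

  private
    T-adj : ℕ → ℕ → Bool
    T-adj x y = T¹₃₃-edge x y ∨ T¹₃₃-edge y x

    -- The order follows the numbering in `T¹₃₃-edge`: the hub takes position 2 as v₃, and the other
    -- end of the cross edge position 3 as w₁.
    named : List (Fin n)
    named = a (nxt i₀) ∷ a (prv i₀) ∷ a i₀ ∷ b j₀ ∷ b (nxt j₀) ∷ b (prv j₀) ∷ []

    ι : Fin 6 → Fin n
    ι = lookup named

    true! : ∀ {x} → T x → x ≡ true
    true! {true} _ = refl

    false! : ∀ {x} → ¬ T x → x ≡ false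
    false! {true}  ¬t = contradiction tt ¬t
    false! {false} _  = refl

    not-crossˡ : ∀ {i j} → i ≢ i₀ → ¬ Adj G (a i) (b j)
    not-crossˡ i≢ e = i≢ (proj₁ (cross-unique e cross))

    not-crossʳ : ∀ {i j} → j ≢ j₀ → ¬ Adj G (a i) (b j)
    not-crossʳ j≢ e = j≢ (proj₂ (cross-unique e cross))

    table : ∀ i j → Graph.adj G (ι i) (ι j) ≡ T-adj (toℕ i) (toℕ j)
    table 0F 0F = Graph.irrefl G _
    table 0F 1F = true! (triangle-a (nxt≢prv i₀))
    table 0F 2F = true! (triangle-a (nxt≢ i₀))
    table 0F 3F = false! (not-crossˡ (nxt≢ i₀))
    table 0F 4F = false! (not-crossˡ (nxt≢ i₀))
    table 0F 5F = false! (not-crossˡ (nxt≢ i₀))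
    table 1F 0F = trans (Graph.sym G _ _) (table 0F 1F)
    table 1F 1F = Graph.irrefl G _
    table 1F 2F = true! (triangle-a (prv≢ i₀))
    table 1F 3F = false! (not-crossˡ (prv≢ i₀))
    table 1F 4F = false! (not-crossˡ (prv≢ i₀))
    table 1F 5F = false! (not-crossˡ (prv≢ i₀))
    table 2F 0F = trans (Graph.sym G _ _) (table 0F 2F)
    table 2F 1F = trans (Graph.sym G _ _) (table 1F 2F)
    table 2F 2F = Graph.irrefl G _
    table 2F 3F = true! cross
    table 2F 4F = false! (not-crossʳ (nxt≢ j₀))
    table 2F 5F = false! (not-crossʳ (prv≢ j₀))
    table 3F 0F = trans (Graph.sym G _ _) (table 0F 3F)
    table 3F 1F = trans (Graph.sym G _ _) (table 1F 3F)
    table 3F 2F = trans (Graph.sym G _ _) (table 2F 3F)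
    table 3F 3F = Graph.irrefl G _
    table 3F 4F = true! (triangle-b (≢-sym (nxt≢ j₀)))
    table 3F 5F = true! (triangle-b (≢-sym (prv≢ j₀)))
    table 4F 0F = trans (Graph.sym G _ _) (table 0F 4F)
    table 4F 1F = trans (Graph.sym G _ _) (table 1F 4F)
    table 4F 2F = trans (Graph.sym G _ _) (table 2F 4F)
    table 4F 3F = trans (Graph.sym G _ _) (table 3F 4F)
    table 4F 4F = Graph.irrefl G _
    table 4F 5F = true! (triangle-b (nxt≢prv j₀))
    table 5F 0F = trans (Graph.sym G _ _) (table 0F 5F)
    table 5F 1F = trans (Graph.sym G _ _) (table 1F 5F)
    table 5F 2F = trans (Graph.sym G _ _) (table 2F 5F)
    table 5F 3F = trans (Graph.sym G _ _) (table 3F 5F)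
    table 5F 4F = trans (Graph.sym G _ _) (table 4F 5F)
    table 5F 5F = Graph.irrefl G _

    outer : ∀ i {w} → w ∉ six a b → ∀ m → Graph.adj G (ι i) w ≡ T-adj (toℕ i) (6 + m)
    outer 0F w∉ m = false! (hub-only w∉ _ (nxt≢ i₀))
    outer 1F w∉ m = false! (hub-only w∉ _ (prv≢ i₀))
    outer 2F w∉ m = true! (hub-all w∉)
    outer 3F w∉ m = false! (no-b w∉ _)
    outer 4F w∉ m = false! (no-b w∉ _)
    outer 5F w∉ m = false! (no-b w∉ _)

    ι-injective : ∀ i j → ι i ≡ ι j → i ≡ j
    ι-injective = lookup-injective
      ((a≢ (nxt≢prv i₀) ∷ a≢ (nxt≢ i₀) ∷ a≢b _ _ ∷ a≢b _ _ ∷ a≢b _ _ ∷ []) ∷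
       (a≢ (prv≢ i₀) ∷ a≢b _ _ ∷ a≢b _ _ ∷ a≢b _ _ ∷ []) ∷
       (a≢b _ _ ∷ a≢b _ _ ∷ a≢b _ _ ∷ []) ∷
       (b≢ (≢-sym (nxt≢ j₀)) ∷ b≢ (≢-sym (prv≢ j₀)) ∷ []) ∷
       (b≢ (nxt≢prv j₀) ∷ []) ∷ [] ∷ [])
      where
      a≢ : ∀ {i j} → i ≢ j → a i ≢ a j
      a≢ = triangle-≢ G triangle-a
      b≢ : ∀ {i j} → i ≢ j → b i ≢ b j
      b≢ = triangle-≢ G triangle-b

    a-named : ∀ i → ∃[ x ] a i ≡ ι x
    a-named i with i ≟ i₀
    ... | yes refl = 2F , refl
    ... | no i≢ with ≢⇒nxt⊎prv i₀ i i≢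
    ... | inj₁ refl = 0F , refl
    ... | inj₂ refl = 1F , refl

    b-named : ∀ j → ∃[ x ] b j ≡ ι x
    b-named j with j ≟ j₀
    ... | yes refl = 3F , refl
    ... | no j≢ with ≢⇒nxt⊎prv j₀ j j≢
    ... | inj₁ refl = 4F , refl
    ... | inj₂ refl = 5F , refl

    named-or-outside : ∀ v → ∃[ x ] v ≡ ι x ⊎ v ∉ six a b
    named-or-outside v with v ∈ₗ? six a b
    ... | no v∉ = inj₂ v∉
    ... | yes v∈ with ∈-six⁻ a b v∈
    ... | inj₁ (i , refl) = inj₁ (a-named i)
    ... | inj₂ (j , refl) = inj₁ (b-named j)

    ι-∈six : ∀ x → ι x ∈ₗ six a b
    ι-∈six 0F = a∈six a b _
    ι-∈six 1F = a∈six a b _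
    ι-∈six 2F = a∈six a b _
    ι-∈six 3F = b∈six a b _
    ι-∈six 4F = b∈six a b _
    ι-∈six 5F = b∈six a b _

  ≅T¹₃₃ : G ≅ T¹₃₃ n
  ≅T¹₃₃ = build (extend-to-permutation ι ι-injective)
    where
    build : Σ[ π ∈ Permutation′ n ] (∀ i → toℕ (π ⟨$⟩ʳ ι i) ≡ toℕ i) → G ≅ T¹₃₃ n
    build (π , p) = π , λ u v → go u v (named-or-outside u) (named-or-outside v)
      where
      code : Fin n → ℕ
      code u = toℕ (π ⟨$⟩ʳ u)
      -- All codes below 6 are taken by the named vertices, so an outside vertex receives the code
      -- of a leaf.
      far : ∀ {w} → w ∉ six a b → ∃[ m ] code w ≡ 6 + m
      far {w} w∉ with 6 ≤? code w
      ... | yes 6≤ = _ , sym (ℕ.m+[n∸m]≡n 6≤)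
      ... | no 6≰ = contradiction (ι-∈six x) (subst (_∉ six a b) w≡ w∉)
        where
        lt = ℕ.≰⇒> 6≰
        x = fromℕ< lt
        w≡ : w ≡ ι x
        w≡ = trans (sym (inverseˡ π)) (trans
          (cong (π ⟨$⟩ˡ_) (toℕ-injective (sym (trans (p x) (toℕ-fromℕ< lt))))) (inverseˡ π))
      go : ∀ u v → ∃[ x ] u ≡ ι x ⊎ u ∉ six a b → ∃[ x ] v ≡ ι x ⊎ v ∉ six a b →
        Graph.adj G u v ≡ T-adj (code u) (code v)
      go _ _ (inj₁ (x , refl)) (inj₁ (y , refl)) =
        trans (table x y) (sym (cong₂ T-adj (p x) (p y)))
      go _ v (inj₁ (x , refl)) (inj₂ v∉) = let m , eq = far v∉ in
        trans (outer x v∉ m) (sym (cong₂ T-adj (p x) eq))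
      go u _ (inj₂ u∉) (inj₁ (y , refl)) = let m , eq = far u∉ in
        trans (Graph.sym G _ _) (trans (outer y u∉ m)
          (trans (sym (cong₂ T-adj (p y) eq)) (∨-comm (T¹₃₃-edge (code (ι y)) (code u)) _)))
      go u v (inj₂ u∉) (inj₂ v∉) = let m , eq = far u∉ ; m′ , eq′ = far v∉ in
        trans (false! (outside-indep u∉ v∉)) (sym (cong₂ T-adj eq eq′))

-- The case distinction and the comparison with T_n^1(3,3).

module _ {n : ℕ} (G : Graph n) (connected : Connected G) (G≇T : ¬ (G ≅ T¹₃₃ n)) where

  private
    B-nbr? : ∀ (a b : Fin 3 → Fin n) → Dec (∃[ w ] (w ∉ six a b × ∃[ j ] Adj G (b j) w))
    B-nbr? a b = any? λ w → ¬? (w ∈ₗ? six a b) ×-dec any? λ j → T? (Graph.adj G (b j) w)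

  -- With all outside vertices hanging on A, connectivity forces an edge between A and B. A single
  -- hub that is also the end of this edge would make the graph isomorphic to `T¹₃₃ n`; two hubs, or
  -- one elsewhere, are winning cases.
  wins-one-sided : ∀ {a b} (D : Dumbbell G a b) → (∀ {w} → w ∉ six a b → ∀ j → ¬ Adj G (b j) w) →
    ∃[ w ] w ∉ six a b → Wins G (length (outs G D))
  wins-one-sided {a} {b} D no-b (w , w∉) = from (hubs w∉)
    where
    open Dumbbell D
    hubs : ∀ {w} → w ∉ six a b → ∃[ i ] Adj G (a i) w
    hubs w∉ = [ (λ (i , e) → i , adj-sym G e) , (λ (j , e) → contradiction (adj-sym G e) (no-b w∉ j)) ]′
      (outside-nbr w∉)
    cross : ∃[ i₀ ] ∃[ j₀ ] Adj G (a i₀) (b j₀)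
    -- A walk from B to A leaves B along some edge; as B has no outside neighbours, that edge ends
    -- in A.
    cross = leave (step-out {R = Adj G} {Q = On G b} (λ v → any? λ j → v ≟ b j) (connected (b 0F) (a 0F)) (0F , refl)
                   λ (j , eq) → a≢b 0F j eq)
      where
      leave : ∃[ u ] ∃[ v ] (On G b u × ¬ On G b v × Adj G u v) → ∃[ i₀ ] ∃[ j₀ ] Adj G (a i₀) (b j₀)
      leave (_ , v , (j , refl) , v∉b , e) with v ∈ₗ? six a b
      ... | no v∉ = contradiction e (no-b v∉ j)
      ... | yes v∈ with ∈-six⁻ a b v∈
      ... | inj₁ (i , refl) = i , j , adj-sym G e
      ... | inj₂ on-b       = contradiction on-b v∉b
    from : ∃[ i ] Adj G (a i) w → Wins G (length (outs G D))
    from (i , e) = second (any? λ i′ → ¬? (i ≟ i′) ×-dec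
                             any? λ w′ → ¬? (w′ ∈ₗ? six a b) ×-dec T? (Graph.adj G (a i′) w′))
      where
      second : Dec (∃[ i′ ] (i ≢ i′ × ∃[ w′ ] (w′ ∉ six a b × Adj G (a i′) w′))) → Wins G (length (outs G D))
      second (yes (i′ , i≢i′ , w′ , w′∉ , e′)) = wins-two-hubs G D no-b i≢i′ w∉ e w′∉ e′
      second (no single) = let i₀ , _ , x = cross in at x (i ≟ i₀)
        where
        only-hub : ∀ {w} → w ∉ six a b → ∃[ i′ ] Adj G (a i′) w → Adj G (a i) w
        only-hub w∉ (i′ , f) with i ≟ i′
        ... | yes refl = f
        ... | no i≢i′  = contradiction (i′ , i≢i′ , _ , w∉ , f) single
        at : ∀ {i₀ j₀} → Adj G (a i₀) (b j₀) → Dec (i ≡ i₀) → Wins G (length (outs G D))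
        at x (no i≢i₀)  = wins-one-hub G D no-b w∉ e i≢i₀ x λ l∉ f → single (_ , i≢i₀ , _ , l∉ , f)
        at x (yes refl) = contradiction
          (≅T¹₃₃ G D x (λ w∉ → only-hub w∉ (hubs w∉))
            (λ w∉ i′ i′≢ f → single (i′ , ≢-sym i′≢ , _ , w∉ , f)) no-b) G≇T

  -- `rest` filters `allFin n`, so its order is independent of the order in which the six vertices
  -- are listed.
  rest-swap : ∀ (a b : Fin 3 → Fin n) → rest (six a b) ≡ rest (six b a)
  rest-swap a b = filter-≐ (λ v → ¬? (v ∈ₗ? six a b)) (λ v → ¬? (v ∈ₗ? six b a))
    (∉-six-swap G a b , ∉-six-swap G b a) (allFin n)

  -- By symmetry the triangles are named so that A carries the outside vertices if one side carries
  -- them all, and otherwise at least as many as B.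
  dumbbell-wins : ∀ {a b} (D : Dumbbell G a b) → ∃[ w ] w ∉ six a b → Wins G (length (outs G D))
  dumbbell-wins {a} {b} D (w , w∉) = go (B-nbr? a b) (B-nbr? b a)
    where
    D′ : Dumbbell G b a
    D′ = dumbbell-swap G D
    unswap : Wins G (length (outs G D′)) → Wins G (length (outs G D))
    unswap = subst (λ vs → Wins G (length vs)) (rest-swap b a)
    go : Dec (∃[ w ] (w ∉ six a b × ∃[ j ] Adj G (b j) w)) →
         Dec (∃[ w ] (w ∉ six b a × ∃[ i ] Adj G (a i) w)) → Wins G (length (outs G D))
    go (no none) _ = wins-one-sided D (λ v∉ j e → none (_ , v∉ , j , e)) (w , w∉)
    go (yes _) (no none) =
      unswap (wins-one-sided D′ (λ v∉ i e → none (_ , v∉ , i , e)) (w , ∉-six-swap G a b w∉))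
    go (yes (z , z∉ , bz)) (yes (y , y∉ , ay)) =
      [ wins-two-sided G D (∈-filter⁺ (b-nbr? G D) (∈-rest⁺ z∉) bz)
      , (λ le → unswap (wins-two-sided G D′ (∈-filter⁺ (b-nbr? G D′) (∈-rest⁺ y∉) ay) (swapped le)))
      ]′ (ℕ.≤-total (length (b-outs G D)) (length (a-outs G D)))
      where
      swapped : length (a-outs G D) ≤ length (b-outs G D) → length (b-outs G D′) ≤ length (a-outs G D′)
      swapped = subst (λ vs → length (filter (a-nbr? G D) vs) ≤ length (filter (b-nbr? G D) vs)) (rest-swap a b)

wins : ∀ {n} (G : Graph n) → Connected G → ¬ (G ≅ T¹₃₃ n) → ∀ {k a b} → n ≡ 7 + k → Dumbbell G a b →
  Wins G (suc k)
wins {n} G connected G≇T {k} {a} {b} n≡ D =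
  subst (Wins G) k≡ (dumbbell-wins G connected G≇T D (nonempty (outs G D) k≡ ∈-rest⁻))
  where
  k≡ : length (outs G D) ≡ suc k
  k≡ = ℕ.+-cancelˡ-≡ 6 _ _ (trans (sym (n≡6+outs G D)) n≡)
  nonempty : ∀ vs → length vs ≡ suc k → (∀ {v} → v ∈ₗ vs → v ∉ six a b) → ∃[ v ] v ∉ six a b
  nonempty (v ∷ _) _ out = v , out (here refl)

-- `G` is a variable that `T¹₃₃ n` instantiates only at the very end, with `refl` as its table, so
-- that the edge sets stay abstract.
T¹₃₃-avm-upper : ∀ {n k} → n ≡ 6 + k → Fin k → (G : Graph n) →
  (∀ u v → Graph.adj G u v ≡ T¹₃₃-edge (toℕ u) (toℕ v) ∨ T¹₃₃-edge (toℕ v) (toℕ u)) →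
  (3 * k + 7) * totalSize G ≤ (9 * k + 15) * #maximal G
T¹₃₃-avm-upper {k = k} refl l₀ G table = T-avm-upper k G table l₀

𝒞-avm-lower : ∀ {n k} → n ≡ 7 + k → (G : Graph n) → ∀ {p q} → 𝒞 p q G → ¬ (G ≅ T¹₃₃ n) →
  (9 * suc k + 15) * #maximal G < (3 * suc k + 7) * totalSize G
𝒞-avm-lower {n} {k} n≡ G C G≇T = avm-lower G (suc k) ≥2 (by-size2 (withSize2 G) refl)
  where
  open 𝒞 C
  W₁ W₂ : Fin n → Set
  W₁ = On G (Cycle.vertex cycle₁)
  W₂ = On G (Cycle.vertex cycle₂)
  start : ∀ {p} (c : Cycle G p) → On G (Cycle.vertex c) (Cycle.vertex c (fromℕ< (ℕ.≤-trans (s≤s z≤n) (Cycle.3≤p c))))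
  start c = _ , refl
  apart : ∀ {w} → W₁ w → ¬ W₂ w
  apart (i , refl) (j , eq) = disjoint i j eq
  ≥2 : All (λ M → 2 ≤ ∣ M ∣) (maximalMatchings G)
  ≥2 = All.tabulate λ M∈ → size-≥2 G {W₁} {W₂} (cycle-minDegree2 G cycle₁) (cycle-minDegree2 G cycle₂) apart
    (start cycle₁) (start cycle₂) (∈-maximalMatchings⁻ G M∈)
  by-size2 : ∀ Ms → Ms ≡ withSize2 G → Wins G (suc k)
  -- Without matchings of size 2 the average is at least 3; as some maximal matching exists, there
  -- is one of size at least 3.
  by-size2 [] eq = wins-none G (suc k) (ℕ.≤-reflexive (cong length (sym eq)))
    (subst (1 ≤_) (trans (length-by-size ∣_∣ (maximalMatchings G) ≥2)
                     (cong (λ Ms → length Ms + length (withSize≥ G 3)) (sym eq)))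
      (>-nonZero⁻¹ _ {{#maximalMatchings-nonZero G}}))
  by-size2 (M ∷ _) eq =
    let M∈ , size2 = ∈-filter⁻ (λ M → ∣ M ∣ ℕ.≟ 2) {xs = maximalMatchings G} (subst (M ∈ₗ_) eq (here refl))
        _ , _ , D  = dumbbell G connected size {W₁} {W₂} (cycle-minDegree2 G cycle₁) (cycle-minDegree2 G cycle₂)
                       apart {M} (∈-maximalMatchings⁻ G M∈) size2 (start cycle₁) (start cycle₂)
    in wins G connected G≇T n≡ D

theorem4p6 : ∀ (n : ℕ) → 7 ≤ n → (G : Graph n) → (p q : ℕ) → 𝒞 p q G → ¬ (G ≅ T¹₃₃ n) → avm (T¹₃₃ n) ℚ.< avm G
theorem4p6 n 7≤n G p q C G≇T = compare (ℕ.m≤n⇒∃[o]m+o≡n 7≤n)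
  where
  compare : ∃[ k ] 7 + k ≡ n → avm (T¹₃₃ n) ℚ.< avm G
  -- The separating fraction is the value of avm(T_n^1(3,3)) itself; n = 7 + k means k + 1 leaves.
  compare (k , eq) = avm-<-via (T¹₃₃ n) G (3 * suc k + 7) (9 * suc k + 15)
    (T¹₃₃-avm-upper (sym eq) zero (T¹₃₃ n) (λ _ _ → refl)) (𝒞-avm-lower (sym eq) G C G≇T)
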